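{- Let $n\ge 1$ and, for every $i\in[n]$, let $G_i$ be a connected $d_i$-regular graph on $m_i$ vertices (with $m_i$ finite). Let $\mathbf{G}:=G_1\square\cdots\square G_n$ and let $M:=\max_{i\in[n]}m_i$. Then, for every nonempty $A\subseteq V(\mathbf{G})$, $$e_{\mathbf{G}}(A,A^c)\ge|A|\cdot\frac{e}{M}\cdot\log\frac{|V(\mathbf{G})|}{|A|},$$ where on the right-hand side $e$ is Euler's number.
   Context: $\log$ is the natural logarithm and $[n]$ denotes $\{1,\dots,n\}$. For a graph $G$ and $A\subseteq V(G)$, $A^c=V(G)\setminus A$ and $e_G(A,A^c)$ is the number of edges of $G$ with exactly one endpoint in $A$. The product graph $G_1\square\cdots\square G_n$ has vertex set $V(G_1)\times\cdots\times V(G_n)$, and its edges are all pairs $\{u,v\}$ for which there is an index $j\in[n]$ such that $u_jv_j\in E(G_j)$ and $u_l=v_l$ for all $l\neq j$. -}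

module Defs where

import Algebra.Properties.Monoid.Sum as MonoidSum
open import Data.Fin.Base as Fin using (Fin; toℕ)
import Data.Fin.Properties as Fin
open import Data.Integer.Base as ℤ using (+0; +[1+_]; -[1+_])
import Data.Integer.Properties as ℤ
open import Data.List.Base as List using (List; length; filter; cartesianProduct)
open import Data.List.Membership.Propositional using (_∈_)
open import Data.List.Membership.Propositional.Properties
  using (∈-map⁺; ∈-allFin; ∈-filter⁺; ∈-length)
open import Data.Nat.Base as ℕ using (ℕ; zero; suc; z≤n; s≤s)
import Data.Nat.Properties as ℕ
open import Data.Product.Base using (Σ; ∃; ∃-syntax; _×_; _,_; proj₁; proj₂)
open import Data.Product.Function.NonDependent.Propositional using (_×-↔_)
open import Data.Rational.Base
import Data.Rational.Properties as ℚ
open import Data.Rational.Solver using (module +-*-Solver)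
import Data.Rational.Unnormalised.Base as ℚᵘ
import Data.Rational.Unnormalised.Properties as ℚᵘ
open import Data.Sum.Base using (_⊎_; inj₁; inj₂)
open import Data.Unit.Base using (⊤; tt)
open import Data.Vec.Base as Vec using (Vec; []; _∷_; lookup)
open import Function.Base using (_∘_)
open import Function.Bundles using (_↔_; mk↔ₛ′; Inverse)
open import Function.Construct.Composition using (_↔-∘_)
open import Function.Construct.Symmetry using (↔-sym)
open import Function.Properties.Inverse using (Inverse⇒Injection)
open import Level using (0ℓ)
open import Relation.Binary.Construct.Closure.ReflexiveTransitive using (Star)
import Relation.Binary.Definitions as B
open import Relation.Binary.PropositionalEquality
open import Relation.Nullary using (¬_)
open import Relation.Nullary.Decidable using (_×-dec_; _⊎-dec_; _→-dec_; ¬?; via-injection)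
open import Relation.Unary using (Pred; Decidable; Satisfiable)

open import Algebra.Definitions.RawSemiring +-*-rawSemiring using (_^_; sum)

private module R = +-*-Solver
open ℚ.≤-Reasoning

ι : ℕ → ℚ
ι n = (ℤ.+ n) / 1

unit : ℕ → ℚ
unit n = (ℤ.+ 1) / suc n

module ℚ-Lemmas where
  ι-+ : ∀ m n → ι (m ℕ.+ n) ≡ ι m + ι n
  ι-+ m n = ℚ.toℚᵘ-injective (ℚᵘ.≃-trans (ℚ.toℚᵘ-fromℚᵘ (ℚᵘ.mkℚᵘ (ℤ.+ (m ℕ.+ n)) 0))
    (ℚᵘ.≃-sym (ℚᵘ.≃-trans (ℚ.toℚᵘ-homo-+ (ι m) (ι n))
      (ℚᵘ.≃-trans (ℚᵘ.+-cong (ℚ.toℚᵘ-fromℚᵘ (ℚᵘ.mkℚᵘ (ℤ.+ m) 0)) (ℚ.toℚᵘ-fromℚᵘ (ℚᵘ.mkℚᵘ (ℤ.+ n) 0)))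
        (ℚᵘ.*≡* (cong (ℤ._* (ℤ.+ 1)) (cong₂ ℤ._+_ (ℤ.*-identityʳ (ℤ.+ m)) (ℤ.*-identityʳ (ℤ.+ n)))))))))

  ι-suc : ∀ n → ι (suc n) ≡ 1ℚ + ι n
  ι-suc n = ι-+ 1 n

  ι-* : ∀ m n → ι (m ℕ.* n) ≡ ι m * ι n
  ι-* zero    n = sym (ℚ.*-zeroˡ (ι n))
  ι-* (suc m) n = begin-equality
    ι (n ℕ.+ m ℕ.* n)     ≡⟨ ι-+ n (m ℕ.* n) ⟩
    ι n + ι (m ℕ.* n)     ≡⟨ cong (ι n +_) (ι-* m n) ⟩
    ι n + ι m * ι n       ≡⟨ R.solve 2 (λ a b → b R.:+ a R.:* b R.:= (R.con 1ℚ R.:+ a) R.:* b) refl (ι m) (ι n) ⟩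
    (1ℚ + ι m) * ι n      ≡⟨ cong (_* ι n) (sym (ι-suc m)) ⟩
    ι (suc m) * ι n       ∎

  ι*unit : ∀ n → ι (suc n) * unit n ≡ 1ℚ
  ι*unit n = ℚ.toℚᵘ-injective (ℚᵘ.≃-trans (ℚ.toℚᵘ-homo-* (ι (suc n)) (unit n))
    (ℚᵘ.≃-trans (ℚᵘ.*-cong (ℚ.toℚᵘ-fromℚᵘ (ℚᵘ.mkℚᵘ (ℤ.+ suc n) 0)) (ℚ.toℚᵘ-fromℚᵘ (ℚᵘ.mkℚᵘ (ℤ.+ 1) n)))
      (ℚᵘ.*≡* (trans (ℤ.*-identityʳ _) (trans (ℤ.*-identityʳ (ℤ.+ suc n)) (sym (trans (ℤ.*-identityˡ (ℤ.+ (1 ℕ.* suc n))) (cong ℤ.+_ (ℕ.*-identityˡ (suc n))))))))))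

  0≤ι : ∀ n → 0ℚ ≤ ι n
  0≤ι n = ℚ.nonNegative⁻¹ (ι n) {{ℚ.normalize-nonNeg n 1}}

  0<unit : ∀ n → 0ℚ < unit n
  0<unit n = ℚ.positive⁻¹ (unit n) {{ℚ.normalize-pos 1 (suc n)}}

  0≤unit : ∀ n → 0ℚ ≤ unit n
  0≤unit n = ℚ.<⇒≤ (0<unit n)

  ι-mono : ∀ {m n} → m ℕ.≤ n → ι m ≤ ι n
  ι-mono {m} {n} m≤n = begin
    ι m                  ≡⟨ ℚ.+-identityʳ (ι m) ⟨
    ι m + 0ℚ             ≤⟨ ℚ.+-monoʳ-≤ (ι m) (0≤ι (n ℕ.∸ m)) ⟩
    ι m + ι (n ℕ.∸ m)    ≡⟨ ι-+ m (n ℕ.∸ m) ⟨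
    ι (m ℕ.+ (n ℕ.∸ m))  ≡⟨ cong ι (ℕ.m+[n∸m]≡n m≤n) ⟩
    ι n                  ∎

  archimedean : ∀ q → ∃[ n ] q ≤ ι n
  archimedean q@(mkℚ (ℤ.+ n) d c) = n , ℚ.toℚᵘ-cancel-≤
    (ℚᵘ.≤-trans (ℚᵘ.*≤* (ℤ.≤-trans (ℤ.≤-reflexive (ℤ.*-identityʳ (ℤ.+ n))) (ℤ.≤-trans (ℤ.≤-reflexive (sym (ℤ.*-identityʳ (ℤ.+ n)))) (ℤ.*-monoˡ-≤-nonNeg (ℤ.+ n) (ℤ.+≤+ (s≤s z≤n))))))
      (ℚᵘ.≤-reflexive (ℚᵘ.≃-sym (ℚ.toℚᵘ-fromℚᵘ (ℚᵘ.mkℚᵘ (ℤ.+ n) 0)))))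
  archimedean q@(mkℚ (ℤ.-[1+ n ]) d c) = 0 , ℚ.<⇒≤ (ℚ.negative⁻¹ q)

  mulˡ : ∀ {r p q} → 0ℚ ≤ r → p ≤ q → r * p ≤ r * q
  mulˡ {r} 0≤r = ℚ.*-monoˡ-≤-nonNeg r {{nonNegative 0≤r}}

  mulʳ : ∀ {r p q} → 0ℚ ≤ r → p ≤ q → p * r ≤ q * r
  mulʳ {r} 0≤r = ℚ.*-monoʳ-≤-nonNeg r {{nonNegative 0≤r}}

  mul-mono : ∀ {p q r s} → 0ℚ ≤ r → 0ℚ ≤ q → p ≤ q → r ≤ s → p * r ≤ q * s
  mul-mono 0≤r 0≤q p≤q r≤s = ℚ.≤-trans (mulʳ 0≤r p≤q) (mulˡ 0≤q r≤s)

  0≤* : ∀ {p q} → 0ℚ ≤ p → 0ℚ ≤ q → 0ℚ ≤ p * q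
  0≤* {p} {q} 0≤p 0≤q = ℚ.≤-trans (ℚ.≤-reflexive (sym (ℚ.*-zeroʳ p))) (mulˡ 0≤p 0≤q)

  0<* : ∀ {p q} → 0ℚ < p → 0ℚ < q → 0ℚ < p * q
  0<* {p} {q} 0<p 0<q = ℚ.positive⁻¹ (p * q) {{ℚ.pos*pos⇒pos p {{positive 0<p}} q {{positive 0<q}}}}

  0≤+ : ∀ {p q} → 0ℚ ≤ p → 0ℚ ≤ q → 0ℚ ≤ p + q
  0≤+ = ℚ.+-mono-≤

  0≤-⇒≤ : ∀ {p q} → 0ℚ ≤ q - p → p ≤ q
  0≤-⇒≤ {p} {q} h = begin
    p            ≡⟨ ℚ.+-identityʳ p ⟨
    p + 0ℚ       ≤⟨ ℚ.+-monoʳ-≤ p h ⟩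
    p + (q - p)  ≡⟨ R.solve 2 (λ p q → p R.:+ (q R.:- p) R.:= q) refl p q ⟩
    q            ∎

  ≤⇒0≤- : ∀ {p q} → p ≤ q → 0ℚ ≤ q - p
  ≤⇒0≤- {p} {q} h = begin
    0ℚ     ≡⟨ ℚ.+-inverseʳ p ⟨
    p - p  ≤⟨ ℚ.+-monoˡ-≤ (- p) h ⟩
    q - p  ∎

  p≤p+ : ∀ {p q} → 0ℚ ≤ q → p ≤ p + q
  p≤p+ {p} {q} h = ℚ.≤-trans (ℚ.≤-reflexive (sym (ℚ.+-identityʳ p))) (ℚ.+-monoʳ-≤ p h)

  0≤1 : 0ℚ ≤ 1ℚ
  0≤1 = ℚ.nonNegative⁻¹ 1ℚ

  0≤sq : ∀ p → 0ℚ ≤ p * p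
  0≤sq p with ℚ.≤-total 0ℚ p
  ... | inj₁ 0≤p = 0≤* 0≤p 0≤p
  ... | inj₂ p≤0 = ℚ.nonNegative⁻¹ (p * p)
    {{ℚ.nonPos*nonPos⇒nonPos p {{nonPositive p≤0}} p {{nonPositive p≤0}}}}

  ∣-∣-sym : ∀ p q → ∣ p - q ∣ ≡ ∣ q - p ∣
  ∣-∣-sym p q = trans (sym (ℚ.∣-p∣≡∣p∣ (p - q)))
    (cong ∣_∣ (R.solve 2 (λ p q → R.:- (p R.:- q) R.:= q R.:- p) refl p q))

  unit-* : ∀ n k → unit n ≡ ι (suc k) * unit (k ℕ.+ n ℕ.* suc k)
  unit-* n k = begin-equality
    u                                 ≡⟨ ℚ.*-identityʳ u ⟨
    u * 1ℚ                            ≡⟨ cong (u *_) (ι*unit (k ℕ.+ n ℕ.* suc k)) ⟨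
    u * (ι (suc n ℕ.* suc k) * w)     ≡⟨ cong (λ z → u * (z * w)) (ι-* (suc n) (suc k)) ⟩
    u * ((ι (suc n) * ι (suc k)) * w) ≡⟨ R.solve 4 (λ u a b w → u R.:* ((a R.:* b) R.:* w) R.:= (a R.:* u) R.:* (b R.:* w)) refl u (ι (suc n)) (ι (suc k)) w ⟩
    (ι (suc n) * u) * (ι (suc k) * w) ≡⟨ cong (_* (ι (suc k) * w)) (ι*unit n) ⟩
    1ℚ * (ι (suc k) * w)              ≡⟨ ℚ.*-identityˡ _ ⟩
    ι (suc k) * w                     ∎
    where u = unit n
          w = unit (k ℕ.+ n ℕ.* suc k)

open ℚ-Lemmas

IsCauchy : (ℕ → ℚ) → Set
IsCauchy s = ∀ ε → 0ℚ < ε → ∃[ N ] ∀ m n → N ℕ.≤ m → N ℕ.≤ n → ∣ s m - s n ∣ ≤ ε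

-- Cauchy sequences, not quotiented: _≤ℝ_ is the order they induce on the
-- reals they represent.
record ℝ : Set where
  constructor mkℝ
  field
    seq    : ℕ → ℚ
    cauchy : IsCauchy seq

open ℝ public

infix 4 _≤ℝ_ _≥ℝ_

_≤ℝ_ : ℝ → ℝ → Set
x ≤ℝ y = ∀ ε → 0ℚ < ε → ∃[ N ] ∀ n → N ℕ.≤ n → seq x n ≤ seq y n + ε

_≥ℝ_ : ℝ → ℝ → Set
x ≥ℝ y = y ≤ℝ x

fromℚ : ℚ → ℝ
fromℚ q = mkℝ (λ _ → q) λ ε 0<ε → 0 , λ _ _ _ _ →
  ℚ.≤-trans (ℚ.≤-reflexive (cong ∣_∣ (ℚ.+-inverseʳ q))) (ℚ.<⇒≤ 0<ε)

fromℕ : ℕ → ℝ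
fromℕ n = fromℚ (ι n)

module ℝ-Lemmas where
  tail-bound : (x : ℝ) → ∃[ K ] ∃[ N ] 0ℚ < K × (∀ n → N ℕ.≤ n → ∣ seq x n ∣ ≤ K)
  tail-bound x with cauchy x 1ℚ (ℚ.positive⁻¹ 1ℚ)
  ... | N , h = ∣ s N ∣ + 1ℚ , N
              , ℚ.+-mono-≤-< (ℚ.0≤∣p∣ (s N)) (ℚ.positive⁻¹ 1ℚ)
              , λ n N≤n → begin
      ∣ s n ∣                ≡⟨ cong ∣_∣ (R.solve 2 (λ a b → a R.:= b R.:+ (a R.:- b)) refl (s n) (s N)) ⟩
      ∣ s N + (s n - s N) ∣  ≤⟨ ℚ.∣p+q∣≤∣p∣+∣q∣ (s N) (s n - s N) ⟩
      ∣ s N ∣ + ∣ s n - s N ∣ ≤⟨ ℚ.+-monoʳ-≤ ∣ s N ∣ (h n N N≤n ℕ.≤-refl) ⟩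
      ∣ s N ∣ + 1ℚ ∎
    where s = seq x

  inverse : ∀ {p} → 0ℚ < p → ∃[ i ] 0ℚ < i × p * i ≡ 1ℚ
  inverse {p} 0<p = (1/ p) {{nz}} , ℚ.positive⁻¹ ((1/ p) {{nz}}) {{ℚ.1/pos⇒pos p {{positive 0<p}}}}
                  , ℚ.*-inverseʳ p {{nz}}
    where nz = ℚ.pos⇒nonZero p {{positive 0<p}}

  product-close : ∀ {a b c d K L ε i} → 0ℚ ≤ K → 0ℚ ≤ ε * i → (K + L) * i ≡ 1ℚ →
    ∣ a ∣ ≤ K → ∣ d ∣ ≤ L → ∣ b - d ∣ ≤ ε * i → ∣ a - c ∣ ≤ ε * i →
    ∣ a * b - c * d ∣ ≤ ε
  product-close {a} {b} {c} {d} {K} {L} {ε} {i} 0≤K 0≤δ inv a≤ d≤ bd ac = begin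
    ∣ a * b - c * d ∣                      ≡⟨ cong ∣_∣ (R.solve 4 (λ a b c d → a R.:* b R.:- c R.:* d R.:= a R.:* (b R.:- d) R.:+ (a R.:- c) R.:* d) refl a b c d) ⟩
    ∣ a * (b - d) + (a - c) * d ∣          ≤⟨ ℚ.∣p+q∣≤∣p∣+∣q∣ (a * (b - d)) ((a - c) * d) ⟩
    ∣ a * (b - d) ∣ + ∣ (a - c) * d ∣      ≡⟨ cong₂ _+_ (ℚ.∣p*q∣≡∣p∣*∣q∣ a (b - d)) (ℚ.∣p*q∣≡∣p∣*∣q∣ (a - c) d) ⟩
    ∣ a ∣ * ∣ b - d ∣ + ∣ a - c ∣ * ∣ d ∣  ≤⟨ ℚ.+-mono-≤ (mul-mono (ℚ.0≤∣p∣ (b - d)) 0≤K a≤ bd)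
                                                        (mul-mono (ℚ.0≤∣p∣ d) 0≤δ ac d≤) ⟩
    K * (ε * i) + (ε * i) * L              ≡⟨ R.solve 4 (λ K L e i → K R.:* (e R.:* i) R.:+ (e R.:* i) R.:* L R.:= e R.:* ((K R.:+ L) R.:* i)) refl K L ε i ⟩
    ε * ((K + L) * i)                      ≡⟨ cong (ε *_) inv ⟩
    ε * 1ℚ                                 ≡⟨ ℚ.*-identityʳ ε ⟩
    ε                                      ∎

  *-cauchy : (x y : ℝ) → IsCauchy (λ n → seq x n * seq y n)
  *-cauchy x y ε 0<ε =
    let K , Nk , 0<K , bx = tail-bound x
        L , Nl , 0<L , by = tail-bound y
        i , 0<i , inv     = inverse {K + L} (ℚ.+-mono-< {0ℚ} {K} {0ℚ} {L} 0<K 0<L)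
        0<δ               = 0<* {ε} {i} 0<ε 0<i
        Nx , cx           = cauchy x (ε * i) 0<δ
        Ny , cy           = cauchy y (ε * i) 0<δ
        N₁ = Nk ℕ.⊔ Nl
        N₂ = Nx ℕ.⊔ Ny
    in N₁ ℕ.⊔ N₂ , λ m n N≤m N≤n →
      let N₁≤m = ℕ.m⊔n≤o⇒m≤o N₁ N₂ N≤m
          N₁≤n = ℕ.m⊔n≤o⇒m≤o N₁ N₂ N≤n
          N₂≤m = ℕ.m⊔n≤o⇒n≤o N₁ N₂ N≤m
          N₂≤n = ℕ.m⊔n≤o⇒n≤o N₁ N₂ N≤n
      in product-close {seq x m} {seq y m} {seq x n} {seq y n} {K} {L} {ε} {i} (ℚ.<⇒≤ 0<K) (ℚ.<⇒≤ 0<δ) inv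
        (bx m (ℕ.m⊔n≤o⇒m≤o Nk Nl N₁≤m))
        (by n (ℕ.m⊔n≤o⇒n≤o Nk Nl N₁≤n))
        (cy m n (ℕ.m⊔n≤o⇒n≤o Nx Ny N₂≤m) (ℕ.m⊔n≤o⇒n≤o Nx Ny N₂≤n))
        (cx m n (ℕ.m⊔n≤o⇒m≤o Nx Ny N₂≤m) (ℕ.m⊔n≤o⇒m≤o Nx Ny N₂≤n))

open ℝ-Lemmas

infixl 7 _*ℝ_ _/ℝ_

_*ℝ_ : ℝ → ℝ → ℝ
x *ℝ y = mkℝ (λ n → seq x n * seq y n) (*-cauchy x y)

_/ℝ_ : ℝ → (m : ℕ) .{{_ : ℕ.NonZero m}} → ℝ
x /ℝ m = x *ℝ fromℚ ((ℤ.+ 1) / m)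

module Cauchy-Lemmas where
  small : ∀ {B ε i N} m → 0ℚ < ε → ε * i ≡ 1ℚ → (B + B) * i ≤ ι N → N ℕ.≤ m → B * unit m ≤ ½ * ε
  small {B} {ε} {i} {N} m 0<ε inv b N≤m = begin
    B * unit m                      ≡⟨ R.solve 2 (λ B u → B R.:* u R.:= R.con ½ R.:* (((B R.:+ B) R.:* R.con 1ℚ) R.:* u)) refl B (unit m) ⟩
    ½ * (((B + B) * 1ℚ) * unit m)   ≡⟨ cong (λ z → ½ * (((B + B) * z) * unit m)) inv ⟨
    ½ * (((B + B) * (ε * i)) * unit m) ≡⟨ cong (λ z → ½ * (z * unit m)) (R.solve 3 (λ B e i → B R.:* (e R.:* i) R.:= (B R.:* i) R.:* e) refl (B + B) ε i) ⟩
    ½ * ((((B + B) * i) * ε) * unit m) ≤⟨ mulˡ {½} (ℚ.nonNegative⁻¹ ½) (mulʳ {unit m} (0≤unit m) (mulʳ {ε} (ℚ.<⇒≤ 0<ε)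
                                           (ℚ.≤-trans b (ι-mono (ℕ.≤-trans N≤m (ℕ.n≤1+n m)))))) ⟩
    ½ * ((ι (suc m) * ε) * unit m)  ≡⟨ cong (½ *_) (R.solve 3 (λ i e u → (i R.:* e) R.:* u R.:= e R.:* (i R.:* u)) refl (ι (suc m)) ε (unit m)) ⟩
    ½ * (ε * (ι (suc m) * unit m))  ≡⟨ cong (λ z → ½ * (ε * z)) (ι*unit m) ⟩
    ½ * (ε * 1ℚ)                    ≡⟨ cong (½ *_) (ℚ.*-identityʳ ε) ⟩
    ½ * ε                           ∎

  cauchy-from : ∀ s B →
    (∀ m n → ∣ s m - s n ∣ ≤ B * unit m + B * unit n) → IsCauchy s
  cauchy-from s B h ε 0<ε =
    let i , 0<i , inv = inverse {ε} 0<ε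
        N , b = archimedean ((B + B) * i)
    in N , λ m n N≤m N≤n → begin
      ∣ s m - s n ∣            ≤⟨ h m n ⟩
      B * unit m + B * unit n  ≤⟨ ℚ.+-mono-≤ (small {B} {ε} {i} {N} m 0<ε inv b N≤m) (small {B} {ε} {i} {N} n 0<ε inv b N≤n) ⟩
      ½ * ε + ½ * ε            ≡⟨ R.solve 1 (λ e → R.con ½ R.:* e R.:+ R.con ½ R.:* e R.:= e) refl ε ⟩
      ε                        ∎

open Cauchy-Lemmas

-- e is the limit of (1 + 1/N)^N, with N = n + 1 at index n.
eulerSeq : ℕ → ℚ
eulerSeq n = (1ℚ + unit n) ^ suc n

module Euler-Lemmas where
  1+ι≥0 : ∀ n → 0ℚ ≤ 1ℚ + unit n
  1+ι≥0 n = 0≤+ {1ℚ} {unit n} 0≤1 (0≤unit n)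

  0≤^ : ∀ {p} n → 0ℚ ≤ p → 0ℚ ≤ p ^ n
  0≤^ zero    0≤p = 0≤1
  0≤^ {p} (suc n) 0≤p = 0≤* {p} {p ^ n} 0≤p (0≤^ n 0≤p)

  *-^ : ∀ p q n → (p * q) ^ n ≡ p ^ n * q ^ n
  *-^ p q zero    = refl
  *-^ p q (suc n) = trans (cong (p * q *_) (*-^ p q n))
    (R.solve 4 (λ p q a b → (p R.:* q) R.:* (a R.:* b) R.:= (p R.:* a) R.:* (q R.:* b)) refl p q (p ^ n) (q ^ n))

  bernoulli : ∀ t n → 0ℚ ≤ 1ℚ + t → 1ℚ + ι n * t ≤ (1ℚ + t) ^ n
  bernoulli t zero    h = ℚ.≤-reflexive (trans (cong (λ z → 1ℚ + z) (ℚ.*-zeroˡ t)) (ℚ.+-identityʳ 1ℚ))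
  bernoulli t (suc n) h = begin
    1ℚ + ι (suc n) * t                  ≡⟨ cong (λ z → 1ℚ + z * t) (ι-suc n) ⟩
    1ℚ + (1ℚ + ι n) * t                 ≤⟨ p≤p+ {1ℚ + (1ℚ + ι n) * t} {ι n * (t * t)} (0≤* {ι n} {t * t} (0≤ι n) (0≤sq t)) ⟩
    1ℚ + (1ℚ + ι n) * t + ι n * (t * t) ≡⟨ R.solve 2 (λ k t → R.con 1ℚ R.:+ (R.con 1ℚ R.:+ k) R.:* t R.:+ k R.:* (t R.:* t) R.:= (R.con 1ℚ R.:+ t) R.:* (R.con 1ℚ R.:+ k R.:* t)) refl (ι n) t ⟩
    (1ℚ + t) * (1ℚ + ι n * t)           ≤⟨ mulˡ {1ℚ + t} h (bernoulli t n h) ⟩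
    (1ℚ + t) * (1ℚ + t) ^ n             ∎

  unit-rel : ∀ n → unit (suc n) ≡ unit n * (1ℚ - unit (suc n))
  unit-rel n = sym (begin-equality
    v * (1ℚ - w)                            ≡⟨ cong (λ z → v * (z - w)) (ι*unit (suc n)) ⟨
    v * (ι (suc (suc n)) * w - w)           ≡⟨ cong (λ z → v * (z * w - w)) (ι-suc (suc n)) ⟩
    v * ((1ℚ + ι (suc n)) * w - w)          ≡⟨ R.solve 3 (λ v w k → v R.:* ((R.con 1ℚ R.:+ k) R.:* w R.:- w) R.:= (k R.:* v) R.:* w) refl v w (ι (suc n)) ⟩
    (ι (suc n) * v) * w                     ≡⟨ cong (_* w) (ι*unit n) ⟩
    1ℚ * w                                  ≡⟨ ℚ.*-identityˡ w ⟩
    w                                       ∎)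
    where v = unit n
          w = unit (suc n)

  unit≤1 : ∀ n → unit n ≤ 1ℚ
  unit≤1 n = begin
    unit n                       ≡⟨ ℚ.*-identityˡ (unit n) ⟨
    1ℚ * unit n                  ≤⟨ mulʳ {unit n} {1ℚ} {ι (suc n)} (0≤unit n) (ι-mono {1} {suc n} (s≤s z≤n)) ⟩
    ι (suc n) * unit n           ≡⟨ ι*unit n ⟩
    1ℚ                           ∎

  -- p = 1 + 1/N, q = 1 + 1/(N+1): q = p (1 - 1/(N+1)²)
  euler-step : ∀ n → eulerSeq n ≤ eulerSeq (suc n)
  euler-step n = begin
    p ^ N                                ≡⟨ ℚ.*-identityʳ (p ^ N) ⟨
    p ^ N * 1ℚ                           ≡⟨ cong (p ^ N *_) p[1-w] ⟨
    p ^ N * (p * (1ℚ - w))               ≡⟨ R.solve 3 (λ a p z → a R.:* (p R.:* z) R.:= (p R.:* a) R.:* z) refl (p ^ N) p (1ℚ - w) ⟩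
    p ^ suc N * (1ℚ - w)                 ≡⟨ cong (λ z → p ^ suc N * z) ιw ⟨
    p ^ suc N * (1ℚ + ι (suc N) * (- (w * w))) ≤⟨ mulˡ {p ^ suc N} (0≤^ (suc N) (1+ι≥0 n)) (bernoulli (- (w * w)) (suc N) 1-w²≥0) ⟩
    p ^ suc N * (1ℚ + (- (w * w))) ^ suc N     ≡⟨ *-^ p (1ℚ + (- (w * w))) (suc N) ⟨
    (p * (1ℚ + (- (w * w)))) ^ suc N     ≡⟨ cong (_^ suc N) q≡ ⟩
    (1ℚ + w) ^ suc N                     ∎
    where
    N = suc n
    v = unit n
    w = unit (suc n)
    p = 1ℚ + v
    p[1-w] : p * (1ℚ - w) ≡ 1ℚ
    p[1-w] = begin-equality
      (1ℚ + v) * (1ℚ - w)       ≡⟨ R.solve 2 (λ v w → (R.con 1ℚ R.:+ v) R.:* (R.con 1ℚ R.:- w) R.:= R.con 1ℚ R.:- w R.:+ v R.:* (R.con 1ℚ R.:- w)) refl v w ⟩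
      1ℚ - w + v * (1ℚ - w)     ≡⟨ cong (λ z → 1ℚ - w + z) (unit-rel n) ⟨
      1ℚ - w + w                ≡⟨ R.solve 1 (λ w → R.con 1ℚ R.:- w R.:+ w R.:= R.con 1ℚ) refl w ⟩
      1ℚ                        ∎
    ιw : 1ℚ + ι (suc N) * (- (w * w)) ≡ 1ℚ - w
    ιw = begin-equality
      1ℚ + ι (suc N) * (- (w * w)) ≡⟨ R.solve 2 (λ k w → R.con 1ℚ R.:+ k R.:* (R.:- (w R.:* w)) R.:= R.con 1ℚ R.:- (k R.:* w) R.:* w) refl (ι (suc N)) w ⟩
      1ℚ - (ι (suc N) * w) * w     ≡⟨ cong (λ z → 1ℚ - z * w) (ι*unit N) ⟩
      1ℚ - 1ℚ * w                  ≡⟨ cong (λ z → 1ℚ - z) (ℚ.*-identityˡ w) ⟩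
      1ℚ - w                       ∎
    1-w²≥0 : 0ℚ ≤ 1ℚ + (- (w * w))
    1-w²≥0 = ≤⇒0≤- {w * w} {1ℚ} (ℚ.≤-trans (mul-mono {w} {1ℚ} {w} {1ℚ} (0≤unit N) 0≤1 (unit≤1 N) (unit≤1 N)) (ℚ.≤-reflexive (ℚ.*-identityˡ 1ℚ)))
    q≡ : p * (1ℚ + (- (w * w))) ≡ 1ℚ + w
    q≡ = begin-equality
      p * (1ℚ + (- (w * w)))      ≡⟨ R.solve 2 (λ p w → p R.:* (R.con 1ℚ R.:+ (R.:- (w R.:* w))) R.:= (p R.:* (R.con 1ℚ R.:- w)) R.:* (R.con 1ℚ R.:+ w)) refl p w ⟩
      (p * (1ℚ - w)) * (1ℚ + w)   ≡⟨ cong (_* (1ℚ + w)) p[1-w] ⟩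
      1ℚ * (1ℚ + w)               ≡⟨ ℚ.*-identityˡ (1ℚ + w) ⟩
      1ℚ + w                      ∎

  eulerUpper : ℕ → ℚ
  eulerUpper n = (1ℚ + unit n) ^ suc (suc n)

  upper-step : ∀ n → eulerUpper (suc n) ≤ eulerUpper n
  upper-step n = begin
    q ^ suc (suc N)                         ≡⟨ ℚ.*-comm q (q ^ suc N) ⟩
    q ^ suc N * (1ℚ + w)                    ≤⟨ mulˡ {q ^ suc N} (0≤^ (suc N) (1+ι≥0 (suc n))) (ℚ.+-monoʳ-≤ 1ℚ w≤) ⟩
    q ^ suc N * (1ℚ + ι (suc N) * (v * z))  ≤⟨ mulˡ {q ^ suc N} (0≤^ (suc N) (1+ι≥0 (suc n))) (bernoulli (v * z) (suc N) (0≤+ {1ℚ} {v * z} 0≤1 (0≤* {v} {z} (0≤unit n) (0≤unit (suc N))))) ⟩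
    q ^ suc N * (1ℚ + v * z) ^ suc N        ≡⟨ *-^ q (1ℚ + v * z) (suc N) ⟨
    (q * (1ℚ + v * z)) ^ suc N              ≡⟨ cong (_^ suc N) p≡ ⟩
    (1ℚ + v) ^ suc N                        ∎
    where
    N = suc n
    v = unit n
    w = unit N
    z = unit (suc N)
    q = 1ℚ + w
    v≡ : v ≡ w + v * w
    v≡ = begin-equality
      v                       ≡⟨ R.solve 2 (λ v w → v R.:= v R.:* (R.con 1ℚ R.:- w) R.:+ v R.:* w) refl v w ⟩
      v * (1ℚ - w) + v * w    ≡⟨ cong (_+ v * w) (unit-rel n) ⟨
      w + v * w               ∎
    w≡ : w ≡ z + w * z
    w≡ = begin-equality
      w                       ≡⟨ R.solve 2 (λ v w → v R.:= v R.:* (R.con 1ℚ R.:- w) R.:+ v R.:* w) refl w z ⟩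
      w * (1ℚ - z) + w * z    ≡⟨ cong (_+ w * z) (unit-rel N) ⟨
      z + w * z               ∎
    w≤v : w ≤ v
    w≤v = ℚ.≤-trans (p≤p+ {w} {v * w} (0≤* {v} {w} (0≤unit n) (0≤unit N))) (ℚ.≤-reflexive (sym v≡))
    w≤ : w ≤ ι (suc N) * (v * z)
    w≤ = begin
      w                          ≡⟨ w≡ ⟩
      z + w * z                  ≤⟨ ℚ.+-monoʳ-≤ z (mulʳ {z} {w} {v} (0≤unit (suc N)) w≤v) ⟩
      z + v * z                  ≡⟨ cong (_+ v * z) (ℚ.*-identityˡ z) ⟨
      1ℚ * z + v * z             ≡⟨ cong (λ a → a * z + v * z) (ι*unit n) ⟨
      (ι N * v) * z + v * z      ≡⟨ R.solve 3 (λ k v z → (k R.:* v) R.:* z R.:+ v R.:* z R.:= (R.con 1ℚ R.:+ k) R.:* (v R.:* z)) refl (ι N) v z ⟩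
      (1ℚ + ι N) * (v * z)       ≡⟨ cong (_* (v * z)) (ι-suc N) ⟨
      ι (suc N) * (v * z)        ∎
    p≡ : q * (1ℚ + v * z) ≡ 1ℚ + v
    p≡ = begin-equality
      (1ℚ + w) * (1ℚ + v * z)             ≡⟨ R.solve 3 (λ v w z → (R.con 1ℚ R.:+ w) R.:* (R.con 1ℚ R.:+ v R.:* z) R.:= R.con 1ℚ R.:+ (w R.:+ v R.:* (z R.:+ w R.:* z))) refl v w z ⟩
      1ℚ + (w + v * (z + w * z))          ≡⟨ cong (λ a → 1ℚ + (w + v * a)) w≡ ⟨
      1ℚ + (w + v * w)                    ≡⟨ cong (λ z → 1ℚ + z) v≡ ⟨
      1ℚ + v                              ∎

  step-mono : ∀ (f : ℕ → ℚ) → (∀ n → f n ≤ f (suc n)) → ∀ {m n} → m ℕ.≤′ n → f m ≤ f n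
  step-mono f h (ℕ.≤′-reflexive refl) = ℚ.≤-refl
  step-mono f h (ℕ.≤′-step m≤n)       = ℚ.≤-trans (step-mono f h m≤n) (h _)

  step-antimono : ∀ (f : ℕ → ℚ) → (∀ n → f (suc n) ≤ f n) → ∀ {m n} → m ℕ.≤′ n → f n ≤ f m
  step-antimono f h (ℕ.≤′-reflexive refl) = ℚ.≤-refl
  step-antimono f h (ℕ.≤′-step m≤n)       = ℚ.≤-trans (h _) (step-antimono f h m≤n)

  euler≤upper : ∀ n → eulerSeq n ≤ eulerUpper n
  euler≤upper n = begin
    eulerSeq n          ≡⟨ ℚ.*-identityˡ (eulerSeq n) ⟨
    1ℚ * eulerSeq n     ≤⟨ mulʳ {eulerSeq n} {1ℚ} {1ℚ + unit n} (0≤^ (suc n) (1+ι≥0 n)) (p≤p+ {1ℚ} {unit n} (0≤unit n)) ⟩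
    eulerUpper n        ∎

  euler-tail : ∀ {m n} → n ℕ.≤ m → eulerSeq m ≤ eulerSeq n + ι 4 * unit n
  euler-tail {m} {n} n≤m = begin
    eulerSeq m                        ≤⟨ euler≤upper m ⟩
    eulerUpper m                      ≤⟨ step-antimono eulerUpper upper-step (ℕ.≤⇒≤′ n≤m) ⟩
    eulerUpper n                      ≡⟨ R.solve 2 (λ v a → (R.con 1ℚ R.:+ v) R.:* a R.:= a R.:+ a R.:* v) refl (unit n) (eulerSeq n) ⟩
    eulerSeq n + eulerSeq n * unit n  ≤⟨ ℚ.+-monoʳ-≤ (eulerSeq n) (mulʳ {unit n} (0≤unit n) euler≤4) ⟩
    eulerSeq n + ι 4 * unit n         ∎
    where
    euler≤4 : eulerSeq n ≤ ι 4
    euler≤4 = ℚ.≤-trans (euler≤upper n) (step-antimono eulerUpper upper-step (ℕ.≤⇒≤′ (z≤n {n})))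

  ordered-close : ∀ {a b c d} → a ≤ b → b ≤ a + c → 0ℚ ≤ d → ∣ a - b ∣ ≤ c + d
  ordered-close {a} {b} {c} {d} a≤b b≤ 0≤d = begin
    ∣ a - b ∣    ≡⟨ ∣-∣-sym a b ⟩
    ∣ b - a ∣    ≡⟨ ℚ.0≤p⇒∣p∣≡p (≤⇒0≤- {a} {b} a≤b) ⟩
    b - a        ≤⟨ ℚ.+-monoˡ-≤ (- a) b≤ ⟩
    a + c - a    ≡⟨ R.solve 2 (λ a c → a R.:+ c R.:- a R.:= c) refl a c ⟩
    c            ≤⟨ p≤p+ {c} {d} 0≤d ⟩
    c + d        ∎

  euler-close : ∀ m n → ∣ eulerSeq m - eulerSeq n ∣ ≤ ι 4 * unit m + ι 4 * unit n
  euler-close m n with ℕ.≤-total m n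
  ... | inj₁ m≤n = ordered-close {eulerSeq m} {eulerSeq n} (step-mono eulerSeq euler-step (ℕ.≤⇒≤′ m≤n)) (euler-tail m≤n)
                     (0≤* {ι 4} {unit n} (0≤ι 4) (0≤unit n))
  ... | inj₂ n≤m = begin
    ∣ eulerSeq m - eulerSeq n ∣      ≡⟨ ∣-∣-sym (eulerSeq m) (eulerSeq n) ⟩
    ∣ eulerSeq n - eulerSeq m ∣      ≤⟨ ordered-close {eulerSeq n} {eulerSeq m} (step-mono eulerSeq euler-step (ℕ.≤⇒≤′ n≤m)) (euler-tail n≤m)
                                        (0≤* {ι 4} {unit m} (0≤ι 4) (0≤unit m)) ⟩
    ι 4 * unit n + ι 4 * unit m      ≡⟨ ℚ.+-comm (ι 4 * unit n) (ι 4 * unit m) ⟩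
    ι 4 * unit m + ι 4 * unit n      ∎

open Euler-Lemmas

𝕖 : ℝ
𝕖 = mkℝ eulerSeq (cauchy-from eulerSeq (ι 4) euler-close)

-- Natural logarithm of a positive rational: log x = ∫₁ˣ dt/t (oriented, so
-- negative for x < 1), the limit of the right-endpoint Riemann sums over the
-- partitions of the interval between 1 and x into n + 1 equal parts.
mesh : ℚ → ℕ → ℚ
mesh x n = (x - 1ℚ) * unit n

node : ℚ → (n : ℕ) → Fin (suc n) → ℚ
node x n i = 1ℚ + ι (suc (toℕ i)) * mesh x n

module Node-Lemmas where
  node-split : ∀ x n l → 1ℚ + ι (suc l) * mesh x n ≡
    (1ℚ - ι (suc l) * unit n) + (ι (suc l) * unit n) * x
  node-split x n l = R.solve 3 (λ x u k →
    R.con 1ℚ R.:+ k R.:* ((x R.:- R.con 1ℚ) R.:* u) R.:= (R.con 1ℚ R.:- k R.:* u) R.:+ (k R.:* u) R.:* x)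
    refl x (unit n) (ι (suc l))

  0<ι : ∀ l → 0ℚ < ι (suc l)
  0<ι l = ℚ.positive⁻¹ (ι (suc l)) {{ℚ.normalize-pos (suc l) 1}}

  fraction≤1 : ∀ {l n} → l ℕ.≤ n → 0ℚ ≤ 1ℚ - ι (suc l) * unit n
  fraction≤1 {l} {n} l≤n = ≤⇒0≤- {ι (suc l) * unit n} {1ℚ} (begin
    ι (suc l) * unit n   ≤⟨ mulʳ {unit n} (0≤unit n) (ι-mono (s≤s l≤n)) ⟩
    ι (suc n) * unit n   ≡⟨ ι*unit n ⟩
    1ℚ                   ∎)

  0<node : ∀ {x l n} → 0ℚ < x → l ℕ.≤ n → 0ℚ < 1ℚ + ι (suc l) * mesh x n
  0<node {x} {l} {n} 0<x l≤n = subst (0ℚ <_) (sym (node-split x n l))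
    (ℚ.+-mono-≤-< {0ℚ} {1ℚ - ι (suc l) * unit n} {0ℚ} {(ι (suc l) * unit n) * x}
      (fraction≤1 l≤n) (0<* {ι (suc l) * unit n} {x} (0<* {ι (suc l)} {unit n} (0<ι l) (0<unit n)) 0<x))

open Node-Lemmas

node-positive : ∀ x .{{_ : Positive x}} n i → Positive (node x n i)
node-positive x n i = positive (0<node {x} {toℕ i} {n} (ℚ.positive⁻¹ x) (ℕ.≤-pred (Fin.toℕ<n i)))

riemann : (x : ℚ) .{{_ : Positive x}} → ℕ → ℚ
riemann x n = sum {suc n} λ i →
  (1/ node x n i) {{ℚ.pos⇒nonZero (node x n i) {{node-positive x n i}}}} * mesh x n

module Log-Lemmas where
  -- Total reciprocal, used only in the convergence proof
  rc : ℚ → ℚ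
  rc p@(mkℚ +[1+ n ] d c) = 1/ p
  rc _ = 0ℚ

  1/≡rc : ∀ p .{{_ : Positive p}} → (1/ p) {{ℚ.pos⇒nonZero p}} ≡ rc p
  1/≡rc (mkℚ +[1+ n ] d c) = refl

  rc-inv : ∀ {p} → 0ℚ < p → p * rc p ≡ 1ℚ
  rc-inv {p} 0<p = trans (cong (p *_) (sym (1/≡rc p {{positive 0<p}})))
    (ℚ.*-inverseʳ p {{ℚ.pos⇒nonZero p {{positive 0<p}}}})

  0≤rc : ∀ p → 0ℚ ≤ rc p
  0≤rc p@(mkℚ +[1+ n ] d c) = ℚ.<⇒≤ (ℚ.positive⁻¹ (1/ p) {{ℚ.1/pos⇒pos p}})
  0≤rc (mkℚ +0 d c)         = ℚ.≤-refl
  0≤rc (mkℚ -[1+ n ] d c)   = ℚ.≤-refl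

  -- Bounds 1/t at every node t, since ((1 - s) + s x)(1 + 1/x) ≥ 1 for 0 ≤ s ≤ 1.
  κ : ℚ → ℚ
  κ x = 1ℚ + rc x

  0≤κ : ∀ x → 0ℚ ≤ κ x
  0≤κ x = 0≤+ {1ℚ} {rc x} 0≤1 (0≤rc x)

  rc-node≤κ : ∀ {x l n} → 0ℚ < x → l ℕ.≤ n → rc (1ℚ + ι (suc l) * mesh x n) ≤ κ x
  rc-node≤κ {x} {l} {n} 0<x l≤n = begin
    rc t                ≡⟨ ℚ.*-identityˡ (rc t) ⟨
    1ℚ * rc t           ≤⟨ mulʳ {rc t} {1ℚ} {κ x * t} (0≤rc t) 1≤ ⟩
    (κ x * t) * rc t    ≡⟨ ℚ.*-assoc (κ x) t (rc t) ⟩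
    κ x * (t * rc t)    ≡⟨ cong (κ x *_) (rc-inv {t} (0<node {x} 0<x l≤n)) ⟩
    κ x * 1ℚ            ≡⟨ ℚ.*-identityʳ (κ x) ⟩
    κ x                 ∎
    where
    t = 1ℚ + ι (suc l) * mesh x n
    s = ι (suc l) * unit n
    y = rc x
    0≤s : 0ℚ ≤ s
    0≤s = 0≤* {ι (suc l)} {unit n} (0≤ι (suc l)) (0≤unit n)
    1≤ : 1ℚ ≤ κ x * t
    1≤ = begin
      1ℚ                                       ≤⟨ p≤p+ {1ℚ} {s * x + (1ℚ - s) * y} (0≤+ {s * x} {(1ℚ - s) * y}
                                                    (0≤* {s} {x} 0≤s (ℚ.<⇒≤ 0<x)) (0≤* {1ℚ - s} {y} (fraction≤1 l≤n) (0≤rc x))) ⟩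
      1ℚ + (s * x + (1ℚ - s) * y)              ≡⟨ R.solve 3 (λ s x y → R.con 1ℚ R.:+ (s R.:* x R.:+ (R.con 1ℚ R.:- s) R.:* y)
                                                    R.:= (R.con 1ℚ R.:- s) R.:+ s R.:* x R.:+ (R.con 1ℚ R.:- s) R.:* y R.:+ s R.:* R.con 1ℚ) refl s x y ⟩
      (1ℚ - s) + s * x + (1ℚ - s) * y + s * 1ℚ ≡⟨ cong (λ z → (1ℚ - s) + s * x + (1ℚ - s) * y + s * z) (rc-inv 0<x) ⟨
      (1ℚ - s) + s * x + (1ℚ - s) * y + s * (x * y)
                                               ≡⟨ R.solve 3 (λ s x y → (R.con 1ℚ R.:- s) R.:+ s R.:* x R.:+ (R.con 1ℚ R.:- s) R.:* y R.:+ s R.:* (x R.:* y)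
                                                    R.:= (R.con 1ℚ R.:+ y) R.:* ((R.con 1ℚ R.:- s) R.:+ s R.:* x)) refl s x y ⟩
      κ x * ((1ℚ - s) + s * x)                 ≡⟨ cong (κ x *_) (node-split x n l) ⟨
      κ x * t                                  ∎

  rc-diff : ∀ {a b} → 0ℚ < a → 0ℚ < b → rc a - rc b ≡ (b - a) * (rc a * rc b)
  rc-diff {a} {b} 0<a 0<b = begin-equality
    rc a - rc b                              ≡⟨ cong₂ (λ y z → y - z) (ℚ.*-identityˡ (rc a)) (ℚ.*-identityˡ (rc b)) ⟨
    1ℚ * rc a - 1ℚ * rc b                    ≡⟨ cong₂ (λ y z → y * rc a - z * rc b) (rc-inv {b} 0<b) (rc-inv {a} 0<a) ⟨
    (b * rc b) * rc a - (a * rc a) * rc b    ≡⟨ R.solve 4 (λ a b c d → (b R.:* d) R.:* c R.:- (a R.:* c) R.:* d R.:= (b R.:- a) R.:* (c R.:* d)) refl a b (rc a) (rc b) ⟩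
    (b - a) * (rc a * rc b)                  ∎

  S : ℕ → (ℕ → ℚ) → ℚ
  S zero    f = 0ℚ
  S (suc n) f = f 0 + S n (f ∘ suc)

  sum≡S : ∀ n (t : Fin n → ℚ) f → (∀ i → t i ≡ f (toℕ i)) → sum t ≡ S n f
  sum≡S zero    t f h = refl
  sum≡S (suc n) t f h = cong₂ _+_ (h Fin.zero) (sum≡S n (t ∘ Fin.suc) (f ∘ suc) (h ∘ Fin.suc))

  S-cong : ∀ n {f g : ℕ → ℚ} → (∀ i → f i ≡ g i) → S n f ≡ S n g
  S-cong zero    h = refl
  S-cong (suc n) h = cong₂ _+_ (h 0) (S-cong n (h ∘ suc))

  S-const : ∀ n c → S n (λ _ → c) ≡ ι n * c
  S-const zero    c = sym (ℚ.*-zeroˡ c)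
  S-const (suc n) c = begin-equality
    c + S n (λ _ → c)   ≡⟨ cong (c +_) (S-const n c) ⟩
    c + ι n * c         ≡⟨ R.solve 2 (λ c k → c R.:+ k R.:* c R.:= (R.con 1ℚ R.:+ k) R.:* c) refl c (ι n) ⟩
    (1ℚ + ι n) * c      ≡⟨ cong (_* c) (ι-suc n) ⟨
    ι (suc n) * c       ∎

  S-+ : ∀ a b f → S (a ℕ.+ b) f ≡ S a f + S b (λ i → f (a ℕ.+ i))
  S-+ zero    b f = sym (ℚ.+-identityˡ (S b f))
  S-+ (suc a) b f = trans (cong (f 0 +_) (S-+ a b (f ∘ suc)))
    (sym (ℚ.+-assoc (f 0) (S a (f ∘ suc)) (S b (λ i → f (suc a ℕ.+ i)))))

  S-* : ∀ n k f → S (n ℕ.* k) f ≡ S n (λ i → S k (λ j → f (i ℕ.* k ℕ.+ j)))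
  S-* zero    k f = refl
  S-* (suc n) k f = trans (S-+ k (n ℕ.* k) f) (cong (S k f +_)
    (trans (S-* n k (λ i → f (k ℕ.+ i)))
      (S-cong n λ i → S-cong k λ j → cong f (sym (ℕ.+-assoc k (i ℕ.* k) j)))))

  S-close : ∀ n {f g : ℕ → ℚ} B → (∀ i → i ℕ.< n → ∣ f i - g i ∣ ≤ B) → ∣ S n f - S n g ∣ ≤ ι n * B
  S-close zero    B h = ℚ.≤-reflexive (sym (ℚ.*-zeroˡ B))
  S-close (suc n) {f} {g} B h = begin
    ∣ f 0 + F - (g 0 + G) ∣       ≡⟨ cong ∣_∣ (R.solve 4 (λ a b c d → a R.:+ b R.:- (c R.:+ d) R.:= (a R.:- c) R.:+ (b R.:- d)) refl (f 0) F (g 0) G) ⟩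
    ∣ (f 0 - g 0) + (F - G) ∣     ≤⟨ ℚ.∣p+q∣≤∣p∣+∣q∣ (f 0 - g 0) (F - G) ⟩
    ∣ f 0 - g 0 ∣ + ∣ F - G ∣     ≤⟨ ℚ.+-mono-≤ (h 0 (s≤s z≤n)) (S-close n B (λ i i<n → h (suc i) (s≤s i<n))) ⟩
    B + ι n * B                   ≡⟨ R.solve 2 (λ c k → c R.:+ k R.:* c R.:= (R.con 1ℚ R.:+ k) R.:* c) refl B (ι n) ⟩
    (1ℚ + ι n) * B                ≡⟨ cong (_* B) (ι-suc n) ⟨
    ι (suc n) * B                 ∎
    where F = S n (f ∘ suc)
          G = S n (g ∘ suc)

  term : ℚ → ℕ → ℕ → ℚ
  term x n l = rc (1ℚ + ι (suc l) * mesh x n) * mesh x n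

  riemann≡S : ∀ x .{{_ : Positive x}} n → riemann x n ≡ S (suc n) (term x n)
  riemann≡S x n = sum≡S (suc n) _ (term x n) λ i →
    cong (_* mesh x n) (1/≡rc (node x n i) {{node-positive x n i}})

  refined : ℕ → ℕ → ℕ
  refined n k = k ℕ.+ n ℕ.* suc k

  refined-comm : ∀ n k → refined n k ≡ refined k n
  refined-comm n k = ℕ.suc-injective (ℕ.*-comm (suc n) (suc k))

  mesh-refined : ∀ x n k → mesh x n ≡ ι (suc k) * mesh x (refined n k)
  mesh-refined x n k = trans (cong ((x - 1ℚ) *_) (unit-* n k))
    (R.solve 3 (λ a b c → a R.:* (b R.:* c) R.:= b R.:* (a R.:* c)) refl (x - 1ℚ) (ι (suc k)) (unit (refined n k)))

  constant : ℚ → ℚ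
  constant x = (∣ x - 1ℚ ∣ * ∣ x - 1ℚ ∣) * (κ x * κ x)

  subterm-close : ∀ {x} → 0ℚ < x → ∀ n k {i j} → i ℕ.< suc n → j ℕ.< suc k →
    let h = mesh x n; h′ = mesh x (refined n k) in
    ∣ rc (1ℚ + ι (suc i) * h) * h′ - term x (refined n k) (i ℕ.* suc k ℕ.+ j) ∣
      ≤ (∣ h ∣ * ∣ h′ ∣) * (κ x * κ x)
  subterm-close {x} 0<x n k {i} {j} i<n j<k = begin
    ∣ rc a * h′ - rc b * h′ ∣              ≡⟨ cong ∣_∣ (R.solve 3 (λ a b h → a R.:* h R.:- b R.:* h R.:= (a R.:- b) R.:* h) refl (rc a) (rc b) h′) ⟩
    ∣ (rc a - rc b) * h′ ∣                 ≡⟨ cong (λ z → ∣ z * h′ ∣) (rc-diff {a} {b} 0<a 0<b) ⟩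
    ∣ ((b - a) * (rc a * rc b)) * h′ ∣     ≡⟨ cong (λ z → ∣ (z * (rc a * rc b)) * h′ ∣) b-a ⟩
    ∣ ((- (ι r * h′)) * (rc a * rc b)) * h′ ∣ ≡⟨ ℚ.∣p*q∣≡∣p∣*∣q∣ ((- (ι r * h′)) * (rc a * rc b)) h′ ⟩
    (∣ (- (ι r * h′)) * (rc a * rc b) ∣) * (∣ h′ ∣) ≡⟨ cong (_* ∣ h′ ∣) (ℚ.∣p*q∣≡∣p∣*∣q∣ (- (ι r * h′)) (rc a * rc b)) ⟩
    ((∣ - (ι r * h′) ∣) * (∣ rc a * rc b ∣)) * (∣ h′ ∣) ≡⟨ cong₂ (λ y z → (y * z) * ∣ h′ ∣) ∣-∣₁ (ℚ.0≤p⇒∣p∣≡p (0≤* {rc a} {rc b} (0≤rc a) (0≤rc b))) ⟩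
    ((ι r * ∣ h′ ∣) * (rc a * rc b)) * ∣ h′ ∣ ≤⟨ mulʳ {∣ h′ ∣} (ℚ.0≤∣p∣ h′) (mul-mono {ι r * ∣ h′ ∣} {∣ h ∣} {rc a * rc b} {κ x * κ x}
                                                  (0≤* {rc a} {rc b} (0≤rc a) (0≤rc b)) (ℚ.0≤∣p∣ h) r≤
                                                  (mul-mono {rc a} {κ x} {rc b} {κ x} (0≤rc b) (0≤κ x) (rc-node≤κ {x} {i} {n} 0<x i≤n) (rc-node≤κ {x} {l} {refined n k} 0<x l≤))) ⟩
    (∣ h ∣ * (κ x * κ x)) * ∣ h′ ∣         ≡⟨ R.solve 3 (λ a b c → (a R.:* b) R.:* c R.:= (a R.:* c) R.:* b) refl (∣ h ∣) (κ x * κ x) (∣ h′ ∣) ⟩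
    (∣ h ∣ * ∣ h′ ∣) * (κ x * κ x)         ∎
    where
    h  = mesh x n
    h′ = mesh x (refined n k)
    l  = i ℕ.* suc k ℕ.+ j
    r  = k ℕ.∸ j
    a  = 1ℚ + ι (suc i) * h
    b  = 1ℚ + ι (suc l) * h′
    i≤n : i ℕ.≤ n
    i≤n = ℕ.≤-pred i<n
    j≤k : j ℕ.≤ k
    j≤k = ℕ.≤-pred j<k
    l+r : suc l ℕ.+ r ≡ suc i ℕ.* suc k
    l+r = cong suc (trans (ℕ.+-assoc (i ℕ.* suc k) j r)
      (trans (cong (i ℕ.* suc k ℕ.+_) (ℕ.m+[n∸m]≡n j≤k)) (ℕ.+-comm (i ℕ.* suc k) k)))
    l≤ : l ℕ.≤ refined n k
    l≤ = ℕ.≤-pred (ℕ.≤-trans (ℕ.m≤m+n (suc l) r) (ℕ.≤-trans (ℕ.≤-reflexive l+r) (ℕ.*-monoˡ-≤ (suc k) i<n)))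
    0<a : 0ℚ < a
    0<a = 0<node {x} {i} {n} 0<x i≤n
    0<b : 0ℚ < b
    0<b = 0<node {x} {l} {refined n k} 0<x l≤
    a≡ : a ≡ 1ℚ + (ι (suc l) + ι r) * h′
    a≡ = begin-equality
      1ℚ + ι (suc i) * h                    ≡⟨ cong (λ z → 1ℚ + ι (suc i) * z) (mesh-refined x n k) ⟩
      1ℚ + ι (suc i) * (ι (suc k) * h′)     ≡⟨ cong (λ z → 1ℚ + z) (ℚ.*-assoc (ι (suc i)) (ι (suc k)) h′) ⟨
      1ℚ + (ι (suc i) * ι (suc k)) * h′     ≡⟨ cong (λ z → 1ℚ + z * h′) (ι-* (suc i) (suc k)) ⟨
      1ℚ + ι (suc i ℕ.* suc k) * h′         ≡⟨ cong (λ z → 1ℚ + ι z * h′) l+r ⟨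
      1ℚ + ι (suc l ℕ.+ r) * h′             ≡⟨ cong (λ z → 1ℚ + z * h′) (ι-+ (suc l) r) ⟩
      1ℚ + (ι (suc l) + ι r) * h′           ∎
    b-a : b - a ≡ - (ι r * h′)
    b-a = trans (cong (λ z → b - z) a≡)
      (R.solve 3 (λ l r h → (R.con 1ℚ R.:+ l R.:* h) R.:- (R.con 1ℚ R.:+ (l R.:+ r) R.:* h) R.:= R.:- (r R.:* h)) refl (ι (suc l)) (ι r) h′)
    ∣-∣₁ : ∣ - (ι r * h′) ∣ ≡ ι r * ∣ h′ ∣
    ∣-∣₁ = trans (ℚ.∣-p∣≡∣p∣ (ι r * h′)) (trans (ℚ.∣p*q∣≡∣p∣*∣q∣ (ι r) h′)
      (cong (_* ∣ h′ ∣) (ℚ.0≤p⇒∣p∣≡p (0≤ι r))))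
    r≤ : ι r * ∣ h′ ∣ ≤ ∣ h ∣
    r≤ = begin
      ι r * ∣ h′ ∣             ≤⟨ mulʳ {∣ h′ ∣} (ℚ.0≤∣p∣ h′) (ι-mono (ℕ.≤-trans (ℕ.m∸n≤m k j) (ℕ.n≤1+n k))) ⟩
      ι (suc k) * ∣ h′ ∣       ≡⟨ cong (_* ∣ h′ ∣) (ℚ.0≤p⇒∣p∣≡p (0≤ι (suc k))) ⟨
      ∣ ι (suc k) ∣ * ∣ h′ ∣   ≡⟨ ℚ.∣p*q∣≡∣p∣*∣q∣ (ι (suc k)) h′ ⟨
      ∣ ι (suc k) * h′ ∣       ≡⟨ cong ∣_∣ (mesh-refined x n k) ⟨
      ∣ h ∣                    ∎

  ∣mesh∣ : ∀ x n → ∣ mesh x n ∣ ≡ ∣ x - 1ℚ ∣ * unit n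
  ∣mesh∣ x n = trans (ℚ.∣p*q∣≡∣p∣*∣q∣ (x - 1ℚ) (unit n)) (cong (∣ x - 1ℚ ∣ *_) (ℚ.0≤p⇒∣p∣≡p (0≤unit n)))

  refine-close : ∀ {x} → 0ℚ < x → ∀ n k →
    ∣ S (suc n) (term x n) - S (suc (refined n k)) (term x (refined n k)) ∣ ≤ constant x * unit n
  refine-close {x} 0<x n k = begin
    ∣ S (suc n) (term x n) - S (suc m) (term x m) ∣   ≡⟨ cong (λ z → ∣ S (suc n) (term x n) - z ∣) (S-* (suc n) (suc k) (term x m)) ⟩
    ∣ S (suc n) (term x n) - S (suc n) (λ i → S (suc k) (λ j → term x m (i ℕ.* suc k ℕ.+ j))) ∣
                                          ≤⟨ S-close (suc n) {term x n} (ι (suc k) * ((D * ∣ h′ ∣) * K)) outer ⟩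
    ι (suc n) * (ι (suc k) * ((D * ∣ h′ ∣) * K))
                                          ≡⟨ R.solve 5 (λ n k d h K → n R.:* (k R.:* ((d R.:* h) R.:* K)) R.:= n R.:* ((d R.:* (k R.:* h)) R.:* K)) refl (ι (suc n)) (ι (suc k)) D (∣ h′ ∣) K ⟩
    ι (suc n) * ((D * (ι (suc k) * ∣ h′ ∣)) * K)
                                          ≡⟨ cong (λ z → ι (suc n) * ((D * z) * K)) k∣h′∣ ⟩
    ι (suc n) * ((D * D) * K)             ≡⟨ cong (λ z → ι (suc n) * ((z * z) * K)) (∣mesh∣ x n) ⟩
    ι (suc n) * (((X * unit n) * (X * unit n)) * K)
                                          ≡⟨ R.solve 4 (λ n X u K → n R.:* (((X R.:* u) R.:* (X R.:* u)) R.:* K) R.:= (n R.:* u) R.:* (((X R.:* X) R.:* K) R.:* u)) refl (ι (suc n)) X (unit n) K ⟩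
    (ι (suc n) * unit n) * (constant x * unit n)
                                          ≡⟨ cong (_* (constant x * unit n)) (ι*unit n) ⟩
    1ℚ * (constant x * unit n)            ≡⟨ ℚ.*-identityˡ (constant x * unit n) ⟩
    constant x * unit n                   ∎
    where
    m  = refined n k
    h  = mesh x n
    h′ = mesh x m
    D  = ∣ h ∣
    X  = ∣ x - 1ℚ ∣
    K  = κ x * κ x
    k∣h′∣ : ι (suc k) * ∣ h′ ∣ ≡ D
    k∣h′∣ = begin-equality
      ι (suc k) * ∣ h′ ∣       ≡⟨ cong (_* ∣ h′ ∣) (ℚ.0≤p⇒∣p∣≡p (0≤ι (suc k))) ⟨
      ∣ ι (suc k) ∣ * ∣ h′ ∣   ≡⟨ ℚ.∣p*q∣≡∣p∣*∣q∣ (ι (suc k)) h′ ⟨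
      ∣ ι (suc k) * h′ ∣       ≡⟨ cong ∣_∣ (mesh-refined x n k) ⟨
      ∣ h ∣                    ∎
    spread : ∀ i → term x n i ≡ S (suc k) (λ _ → rc (1ℚ + ι (suc i) * h) * h′)
    spread i = begin-equality
      rc a * h                       ≡⟨ cong (rc a *_) (mesh-refined x n k) ⟩
      rc a * (ι (suc k) * h′)        ≡⟨ R.solve 3 (λ a k h → a R.:* (k R.:* h) R.:= k R.:* (a R.:* h)) refl (rc a) (ι (suc k)) h′ ⟩
      ι (suc k) * (rc a * h′)        ≡⟨ S-const (suc k) (rc a * h′) ⟨
      S (suc k) (λ _ → rc a * h′)    ∎
      where a = 1ℚ + ι (suc i) * h
    outer : ∀ i → i ℕ.< suc n →
      ∣ term x n i - S (suc k) (λ j → term x m (i ℕ.* suc k ℕ.+ j)) ∣ ≤ ι (suc k) * ((D * ∣ h′ ∣) * K)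
    outer i i<n = begin
      ∣ term x n i - T ∣                                      ≡⟨ cong (λ z → ∣ z - T ∣) (spread i) ⟩
      ∣ S (suc k) (λ _ → rc (1ℚ + ι (suc i) * h) * h′) - T ∣  ≤⟨ S-close (suc k) {λ _ → rc (1ℚ + ι (suc i) * h) * h′} ((D * ∣ h′ ∣) * K)
                                                                   (λ j j<k → subterm-close {x} 0<x n k {i} {j} i<n j<k) ⟩
      ι (suc k) * ((D * ∣ h′ ∣) * K)                          ∎
      where T = S (suc k) (λ j → term x m (i ℕ.* suc k ℕ.+ j))

  riemann-close : ∀ x .{{_ : Positive x}} m n →
    ∣ riemann x m - riemann x n ∣ ≤ constant x * unit m + constant x * unit n
  riemann-close x m n = begin
    ∣ riemann x m - riemann x n ∣          ≡⟨ cong₂ (λ y z → ∣ y - z ∣) (riemann≡S x m) (riemann≡S x n) ⟩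
    ∣ P m - P n ∣                          ≡⟨ cong ∣_∣ (R.solve 3 (λ a b c → a R.:- b R.:= (a R.:- c) R.:+ (c R.:- b)) refl (P m) (P n) (P mn)) ⟩
    ∣ (P m - P mn) + (P mn - P n) ∣        ≤⟨ ℚ.∣p+q∣≤∣p∣+∣q∣ (P m - P mn) (P mn - P n) ⟩
    ∣ P m - P mn ∣ + ∣ P mn - P n ∣        ≡⟨ cong (∣ P m - P mn ∣ +_) (∣-∣-sym (P mn) (P n)) ⟩
    ∣ P m - P mn ∣ + ∣ P n - P mn ∣        ≡⟨ cong (λ z → ∣ P m - P mn ∣ + ∣ P n - P z ∣) (refined-comm m n) ⟩
    ∣ P m - P mn ∣ + ∣ P n - P (refined n m) ∣ ≤⟨ ℚ.+-mono-≤ (refine-close {x} 0<x m n) (refine-close {x} 0<x n m) ⟩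
    constant x * unit m + constant x * unit n ∎
    where
    P : ℕ → ℚ
    P n = S (suc n) (term x n)
    mn = refined m n
    0<x : 0ℚ < x
    0<x = ℚ.positive⁻¹ x

open Log-Lemmas

log : (x : ℚ) .{{_ : Positive x}} → ℝ
log x = mkℝ (riemann x) (cauchy-from (riemann x) (constant x) (riemann-close x))

record Graph : Set₁ where
  infix 4 _~_ _~?_
  field
    V     : Set
    order : ℕ
    enum  : V ↔ Fin order
    _~_   : V → V → Set
    _~?_  : B.Decidable _~_
    ~-sym    : B.Symmetric _~_
    ~-irrefl : ∀ {v} → ¬ (v ~ v)

  index : V → Fin order
  index = Inverse.to enum

  vertices : List V
  vertices = List.map (Inverse.from enum) (List.allFin order)

  _≟_ : B.DecidableEquality V
  _≟_ = via-injection (Inverse⇒Injection enum) Fin._≟_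

  ∈-vertices : ∀ v → v ∈ vertices
  ∈-vertices v = subst (_∈ vertices) (Inverse.strictlyInverseʳ enum v)
    (∈-map⁺ (Inverse.from enum) (∈-allFin (index v)))

  ∣_∣ᵥ : ∀ {A : Pred V 0ℓ} → Decidable A → ℕ
  ∣ A? ∣ᵥ = length (filter A? vertices)

  degree : V → ℕ
  degree v = ∣ v ~?_ ∣ᵥ

  -- Each edge {u , v} is listed once, with its endpoints in increasing order
  -- of index.
  edges : List (V × V)
  edges = filter (λ (u , v) → (index u Fin.<? index v) ×-dec (u ~? v))
                 (cartesianProduct vertices vertices)

  ExactlyOneEndpointIn : Pred V 0ℓ → Pred (V × V) 0ℓ
  ExactlyOneEndpointIn A (u , v) = (A u × ¬ A v) ⊎ (¬ A u × A v)

  exactlyOneEndpointIn? : ∀ {A} → Decidable A → Decidable (ExactlyOneEndpointIn A)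
  exactlyOneEndpointIn? A? (u , v) =
    (A? u ×-dec ¬? (A? v)) ⊎-dec (¬? (A? u) ×-dec A? v)

  -- e(A, Aᶜ)
  edgeBoundary : ∀ {A : Pred V 0ℓ} → Decidable A → ℕ
  edgeBoundary A? = length (filter (exactlyOneEndpointIn? A?) edges)

  Connected : Set
  Connected = ∀ u v → Star _~_ u v

  Regular : ℕ → Set
  Regular d = ∀ v → degree v ≡ d

open Graph public using (V; order)

-- Iterated pairs rather than dependent functions: without function
-- extensionality the latter have no enumeration up to _≡_.
Tuple : ∀ {n} → Vec Graph n → Set
Tuple []       = ⊤
Tuple (G ∷ Gs) = V G × Tuple Gs

component : ∀ {n} {Gs : Vec Graph n} → Tuple Gs → (i : Fin n) → V (lookup Gs i)
component {Gs = _ ∷ _} (u , us) Fin.zero    = u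
component {Gs = _ ∷ _} (u , us) (Fin.suc i) = component us i

Adjacent : ∀ {n} (Gs : Vec Graph n) → Tuple Gs → Tuple Gs → Set
Adjacent Gs u v = ∃[ j ] Graph._~_ (lookup Gs j) (component u j) (component v j)
                       × (∀ l → l ≢ j → component u l ≡ component v l)

productOrder : ∀ {n} → Vec Graph n → ℕ
productOrder = Vec.foldr′ ℕ._*_ 1 ∘ Vec.map order

enumTuple : ∀ {n} (Gs : Vec Graph n) → Tuple Gs ↔ Fin (productOrder Gs)
enumTuple []       = ↔-sym Fin.1↔⊤
enumTuple (G ∷ Gs) = ↔-sym Fin.*↔× ↔-∘ (Graph.enum G ×-↔ enumTuple Gs)

□ : ∀ {n} → Vec Graph n → Graph
□ Gs = record
  { V        = Tuple Gs
  ; order    = productOrder Gs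
  ; enum     = enumTuple Gs
  ; _~_      = Adjacent Gs
  ; _~?_     = λ u v → Fin.any? λ j →
      Graph._~?_ (lookup Gs j) (component u j) (component v j)
      ×-dec Fin.all? λ l → ¬? (l Fin.≟ j)
        →-dec Graph._≟_ (lookup Gs l) (component u l) (component v l)
  ; ~-sym    = λ (j , e , same) →
      j , Graph.~-sym (lookup Gs j) e , λ l l≢j → sym (same l l≢j)
  ; ~-irrefl = λ (j , e , _) → Graph.~-irrefl (lookup Gs j) e
  }

maxOrder : ∀ {n} → Vec Graph (suc n) → ℕ
maxOrder = Vec.foldr₁ ℕ._⊔_ ∘ Vec.map order

order-nonZero : ∀ G → V G → ℕ.NonZero (order G)
order-nonZero G v = Fin.nonZeroIndex (Graph.index G v)

∣∣-nonZero : ∀ G {A : Pred (V G) 0ℓ} (A? : Decidable A) → Satisfiable A →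
             ℕ.NonZero (Graph.∣_∣ᵥ G A?)
∣∣-nonZero G A? (v , Av) = ℕ.>-nonZero (∈-length (∈-filter⁺ A? (Graph.∈-vertices G v) Av))

maxOrder-nonZero : ∀ {n} (Gs : Vec Graph (suc n)) → V (□ Gs) → ℕ.NonZero (maxOrder Gs)
maxOrder-nonZero (G ∷ [])         (v , _)  = order-nonZero G v
maxOrder-nonZero (G ∷ Gs@(_ ∷ _)) (v , _) = ℕ.>-nonZero
  (ℕ.≤-trans (ℕ.>-nonZero⁻¹ (order G) {{order-nonZero G v}}) (ℕ.m≤m⊔n (order G) (maxOrder Gs)))

-- |V(G)| / |A|
coDensity : ∀ G {A : Pred (V G) 0ℓ} (A? : Decidable A) → Satisfiable A → ℚ
coDensity G A? ne = ((ℤ.+ order G) / Graph.∣_∣ᵥ G A?) {{∣∣-nonZero G A? ne}}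

coDensity-positive : ∀ G {A : Pred (V G) 0ℓ} (A? : Decidable A) (ne : Satisfiable A) →
                     Positive (coDensity G A? ne)
coDensity-positive G A? ne@(v , _) = ℚ.normalize-pos (order G) (Graph.∣_∣ᵥ G A?)
  {{∣∣-nonZero G A? ne}} {{order-nonZero G v}}

{-# OPTIONS --safe #-}

-- Let A have size a, and let b run over the sizes of its intersections with the
-- lines of the product. Han's entropy inequality, applied coordinate by coordinate,
-- gives a log (N / a) ≤ Σ b log (m / b), where m is the order of the factor along
-- the line. Full and empty lines contribute nothing, and by connectedness each of
-- the others contains a boundary edge, so there are at most k = e(A, Aᶜ) of them. By
-- concavity of log, a log (N / a) ≤ B log (M k / B), where B is the sum of their b,
-- and the right-hand side is at most M k / e.
--
-- The entropy part is a statement about products of powers of natural numbers. The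
-- last step holds already for every term of the sequences defining e and log: the
-- Riemann sum r of log x satisfies (1 + r / K)ᴷ ≤ x for every K, and
-- (1 + 1 / n)ⁿ s ≤ (1 + s / (n + 1))ⁿ⁺¹ for s ≥ 0.
module Submission where

open import Defs
open import Data.Fin.Base using (Fin)
open import Data.Nat.Base as ℕ using (ℕ; suc)
open import Data.Product.Base using (∃-syntax; _,_; proj₁)
import Data.Rational.Properties as ℚ
open import Data.Vec.Base using (Vec; lookup)
open import Level using (0ℓ)
open import Relation.Binary.PropositionalEquality using (subst; sym)
open import Relation.Unary using (Pred; Decidable; Satisfiable)

-- Powers of natural numbers: Bernoulli, AM-GM and the log-sum inequality.

module LogSum where
  open import Data.Nat.Base
  open import Data.Nat.Properties
  open import Data.Nat.Solver using (module +-*-Solver)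
  open import Data.Fin.Base using (Fin; zero; suc)
  open import Function.Base using (_∘_)
  open import Relation.Binary.PropositionalEquality using (_≡_; refl; sym; trans; cong; cong₂)
  open import Algebra.Properties.CommutativeMonoid.Sum +-0-commutativeMonoid public
    using (∑-comm; ∑-distrib-+; sum-cong-≗; sum-replicate-zero) renaming (sum to ∑)
  open import Algebra.Properties.CommutativeMonoid.Sum *-1-commutativeMonoid public
    using () renaming (sum to ∏; ∑-distrib-+ to ∏-distrib-*; ∑-comm to ∏-comm; sum-cong-≗ to ∏-cong; sum-replicate-zero to ∏-one)
  open ≤-Reasoning
  open +-*-Solver using (solve; _:+_; _:*_; _:=_; con)

  ^-distribʳ-* : ∀ m n k → (m * n) ^ k ≡ m ^ k * n ^ k
  ^-distribʳ-* m n zero    = refl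
  ^-distribʳ-* m n (suc k) = begin-equality
    m * n * (m * n) ^ k       ≡⟨ cong (m * n *_) (^-distribʳ-* m n k) ⟩
    m * n * (m ^ k * n ^ k)   ≡⟨ solve 4 (λ a b c d → a :* b :* (c :* d) := a :* c :* (b :* d)) refl m n (m ^ k) (n ^ k) ⟩
    m * m ^ k * (n * n ^ k)   ∎

  -- The convention 0 ^ 0 = 1 covers empty sets, so factors `n ^ n` can always be cancelled.
  1≤n^n : ∀ n → 1 ≤ n ^ n
  1≤n^n zero    = ≤-refl
  1≤n^n (suc n) = m^n>0 (suc n) (suc n)

  n^n-nonZero : ∀ n → NonZero (n ^ n)
  n^n-nonZero n = >-nonZero (1≤n^n n)

  -- Induction on both arguments takes the place of expanding (x - y)², as subtraction of natural
  -- numbers truncates: raising both by one adds 2 + 2x + 2y to each side.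
  2xy≤x²+y² : ∀ x y → 2 * (x * y) ≤ x * x + y * y
  2xy≤x²+y² zero    y       = z≤n
  2xy≤x²+y² (suc x) zero    = ≤-trans (≤-reflexive (cong (2 *_) (*-zeroʳ x))) z≤n
  2xy≤x²+y² (suc x) (suc y) = begin
    2 * (suc x * suc y)                   ≡⟨ solve 2 (λ x y → con 2 :* ((con 1 :+ x) :* (con 1 :+ y)) := con 2 :* (x :* y) :+ (con 2 :+ con 2 :* x :+ con 2 :* y)) refl x y ⟩
    2 * (x * y) + (2 + 2 * x + 2 * y)     ≤⟨ +-monoˡ-≤ _ (2xy≤x²+y² x y) ⟩
    x * x + y * y + (2 + 2 * x + 2 * y)   ≡⟨ solve 2 (λ x y → x :* x :+ y :* y :+ (con 2 :+ con 2 :* x :+ con 2 :* y) := (con 1 :+ x) :* (con 1 :+ x) :+ (con 1 :+ y) :* (con 1 :+ y)) refl x y ⟩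
    suc x * suc x + suc y * suc y         ∎

  -- Bernoulli's inequality (p/q)ⁿ⁺¹ ≥ 1 + (n+1)(p/q - 1), cleared of
  -- denominators and of subtraction.
  bernoulli-homogeneous : ∀ n p q → suc n * (q ^ n * p) ≤ p ^ suc n + n * q ^ suc n
  bernoulli-homogeneous zero p q = ≤-reflexive
    (solve 1 (λ p → con 1 :* (con 1 :* p) := p :* con 1 :+ con 0) refl p)
  -- The term added to both sides completes the left one to a multiple of 2pq; the induction
  -- hypothesis, multiplied by p, produces the same term on the right.
  bernoulli-homogeneous (suc n) p q = +-cancelʳ-≤ (n * (q * Q * p)) _ _ (begin
    suc (suc n) * (q * Q * p) + n * (q * Q * p)
      ≡⟨ solve 4 (λ n Q p q → (con 2 :+ n) :* (q :* Q :* p) :+ n :* (q :* Q :* p) := (con 1 :+ n) :* Q :* (con 2 :* (p :* q))) refl n Q p q ⟩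
    suc n * Q * (2 * (p * q))
      ≤⟨ *-monoʳ-≤ (suc n * Q) (2xy≤x²+y² p q) ⟩
    suc n * Q * (p * p + q * q)
      ≡⟨ solve 4 (λ n Q p q → (con 1 :+ n) :* Q :* (p :* p :+ q :* q) := (con 1 :+ n) :* (Q :* p) :* p :+ (con 1 :+ n) :* (q :* (q :* Q))) refl n Q p q ⟩
    suc n * (Q * p) * p + suc n * (q * (q * Q))
      ≤⟨ +-monoˡ-≤ _ (*-monoˡ-≤ p (bernoulli-homogeneous n p q)) ⟩
    (p * P + n * (q * Q)) * p + suc n * (q * (q * Q))
      ≡⟨ solve 5 (λ n Q p q P → (p :* P :+ n :* (q :* Q)) :* p :+ (con 1 :+ n) :* (q :* (q :* Q)) := p :* (p :* P) :+ (con 1 :+ n) :* (q :* (q :* Q)) :+ n :* (q :* Q :* p)) refl n Q p q P ⟩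
    p * (p * P) + suc n * (q * (q * Q)) + n * (q * Q * p) ∎)
    where
    P = p ^ n
    Q = q ^ n

  -- AM-GM for x and n copies of s / n, cleared of denominators. It is Bernoulli's inequality at the
  -- ratio p / q of the means (x + s) / (n + 1) and s / n.
  amgm-step : ∀ n x s → x * s ^ n * suc n ^ suc n ≤ n ^ n * (x + s) ^ suc n
  amgm-step zero x s = begin
    x * 1 * 1         ≡⟨ solve 1 (λ x → x :* con 1 :* con 1 := x) refl x ⟩
    x                 ≤⟨ m≤m+n x s ⟩
    x + s             ≡⟨ solve 1 (λ y → y := con 1 :* (y :* con 1)) refl (x + s) ⟩
    1 * ((x + s) * 1) ∎
  amgm-step n@(suc _) x s = *-cancelˡ-≤ n (+-cancelʳ-≤ (n * (q * q ^ n)) _ _ (begin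
    n * (x * s ^ n * (N * N ^ n)) + n * (q * q ^ n)
      ≡⟨ cong (λ z → n * (x * s ^ n * (N * N ^ n)) + n * (q * z)) (^-distribʳ-* N s n) ⟩
    n * (x * s ^ n * (N * N ^ n)) + n * (q * (N ^ n * s ^ n))
      ≡⟨ solve 6 (λ n N x s a b → n :* (x :* a :* (N :* b)) :+ n :* (N :* s :* (b :* a)) := N :* (b :* a :* (n :* (x :+ s)))) refl n N x s (s ^ n) (N ^ n) ⟩
    N * (N ^ n * s ^ n * p)
      ≡⟨ cong (λ z → N * (z * p)) (^-distribʳ-* N s n) ⟨
    N * (q ^ n * p)
      ≤⟨ bernoulli-homogeneous n p q ⟩
    p * p ^ n + n * (q * q ^ n)
      ≡⟨ cong (λ z → p * z + n * (q * q ^ n)) (^-distribʳ-* n (x + s) n) ⟩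
    p * (n ^ n * (x + s) ^ n) + n * (q * q ^ n)
      ≡⟨ cong (_+ n * (q * q ^ n)) (solve 4 (λ n y a b → n :* y :* (a :* b) := n :* (a :* (y :* b))) refl n (x + s) (n ^ n) ((x + s) ^ n)) ⟩
    n * (n ^ n * ((x + s) * (x + s) ^ n)) + n * (q * q ^ n) ∎))
    where
    N = suc n
    p = n * (x + s)
    q = N * s

  -- The hypothesis is AM-GM for n numbers with product P and sum s. Each further factor x is
  -- adjoined by `amgm-step`.
  amgm-copies : ∀ k x {P n s} → P * n ^ n ≤ s ^ n →
    x ^ k * P * (k + n) ^ (k + n) ≤ (k * x + s) ^ (k + n)
  amgm-copies zero    x {P} {n} h = ≤-trans (≤-reflexive (cong (_* n ^ n) (*-identityˡ P))) h
  amgm-copies (suc k) x {P} {n} {s} h = *-cancelʳ-≤ _ _ (m ^ m) {{n^n-nonZero m}} (begin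
    x * x ^ k * P * suc m ^ suc m * m ^ m
      ≡⟨ solve 5 (λ x a P b c → x :* a :* P :* b :* c := x :* (a :* P :* c) :* b) refl x (x ^ k) P (suc m ^ suc m) (m ^ m) ⟩
    x * (x ^ k * P * m ^ m) * suc m ^ suc m
      ≤⟨ *-monoˡ-≤ _ (*-monoʳ-≤ x (amgm-copies k x {P} {n} h)) ⟩
    x * t ^ m * suc m ^ suc m
      ≤⟨ amgm-step m x t ⟩
    m ^ m * (x + t) ^ suc m
      ≡⟨ *-comm (m ^ m) _ ⟩
    (x + t) ^ suc m * m ^ m
      ≡⟨ cong (λ z → z ^ suc m * m ^ m) (+-assoc x (k * x) s) ⟨
    (x + k * x + s) ^ suc m * m ^ m ∎)
    where
    m = k + n
    t = k * x + s

  -- AM-GM for b copies of m / b and c copies of n / c, scaled by b c to the natural numbers `m * c`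
  -- and `n * b`. If b or c is 0, monotonicity of powers suffices.
  log-sum : ∀ b c m n →
    m ^ b * n ^ c * (b + c) ^ (b + c) ≤ b ^ b * c ^ c * (m + n) ^ (b + c)
  log-sum zero      c         m n = ≤-trans
    (≤-reflexive (solve 2 (λ a b → con 1 :* a :* b := con 1 :* b :* a) refl (n ^ c) (c ^ c)))
    (*-monoʳ-≤ (1 * c ^ c) (^-monoˡ-≤ c (m≤n+m n m)))
  log-sum b@(suc _) zero      m n = begin
    m ^ b * 1 * (b + 0) ^ (b + 0) ≡⟨ cong (λ e → m ^ b * 1 * e ^ e) (+-identityʳ b) ⟩
    m ^ b * 1 * b ^ b             ≡⟨ solve 2 (λ p q → p :* con 1 :* q := q :* con 1 :* p) refl (m ^ b) (b ^ b) ⟩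
    b ^ b * 1 * m ^ b             ≤⟨ *-monoʳ-≤ (b ^ b * 1) (^-monoˡ-≤ b (m≤m+n m n)) ⟩
    b ^ b * 1 * (m + n) ^ b       ≡⟨ cong (λ e → b ^ b * 1 * (m + n) ^ e) (+-identityʳ b) ⟨
    b ^ b * 1 * (m + n) ^ (b + 0) ∎
  log-sum b@(suc _) c@(suc _) m n =
    *-cancelʳ-≤ _ _ (c ^ b * b ^ c) {{m*n≢0 (c ^ b) (b ^ c) {{m^n≢0 c b}} {{m^n≢0 b c}}}} (begin
    m ^ b * n ^ c * B * (c ^ b * b ^ c)
      ≡⟨ solve 5 (λ p q B r s → p :* q :* B :* (r :* s) := p :* r :* (q :* s) :* B) refl (m ^ b) (n ^ c) B (c ^ b) (b ^ c) ⟩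
    m ^ b * c ^ b * (n ^ c * b ^ c) * B
      ≡⟨ cong₂ (λ y z → y * z * B) (^-distribʳ-* m c b) (^-distribʳ-* n b c) ⟨
    (m * c) ^ b * (n * b) ^ c * B
      ≤⟨ amgm-copies b (m * c) {_} {c} {c * (n * b)} uniform ⟩
    (b * (m * c) + c * (n * b)) ^ (b + c)
      ≡⟨ cong (_^ (b + c)) (solve 4 (λ b c m n → b :* (m :* c) :+ c :* (n :* b) := b :* (c :* (m :+ n))) refl b c m n) ⟩
    (b * (c * (m + n))) ^ (b + c)
      ≡⟨ trans (^-distribʳ-* b (c * (m + n)) (b + c)) (cong (b ^ (b + c) *_) (^-distribʳ-* c (m + n) (b + c))) ⟩
    b ^ (b + c) * (c ^ (b + c) * (m + n) ^ (b + c))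
      ≡⟨ cong₂ (λ y z → y * (z * (m + n) ^ (b + c))) (^-distribˡ-+-* b b c) (^-distribˡ-+-* c b c) ⟩
    b ^ b * b ^ c * (c ^ b * c ^ c * (m + n) ^ (b + c))
      ≡⟨ solve 5 (λ p q r s t → p :* q :* (r :* s :* t) := p :* s :* t :* (r :* q)) refl (b ^ b) (b ^ c) (c ^ b) (c ^ c) ((m + n) ^ (b + c)) ⟩
    b ^ b * c ^ c * (m + n) ^ (b + c) * (c ^ b * b ^ c) ∎)
    where
    B = (b + c) ^ (b + c)
    uniform : (n * b) ^ c * c ^ c ≤ (c * (n * b)) ^ c
    uniform = ≤-reflexive (trans (*-comm ((n * b) ^ c) (c ^ c)) (sym (^-distribʳ-* c (n * b) c)))

  -- Gain p c B k is B log (B / k) ≤ log (c / p), cleared of denominators and logarithms.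
  Gain : (p c B k : ℕ) → Set
  Gain p c B k = p * B ^ B ≤ c * k ^ B

  -- The two hypotheses add up to a bound on B log (B / k) + B′ log (B′ / k′), and `log-sum` places
  -- the merged term below this sum. Concavity enters here and makes the bounds of separate lines
  -- additive.
  gain-merge : ∀ {p p′ c c′ B B′ k k′} → Gain p c B k → Gain p′ c′ B′ k′ →
    Gain (p * p′) (c * c′) (B + B′) (k + k′)
  gain-merge {p} {p′} {c} {c′} {B} {B′} {k} {k′} g g′ =
    *-cancelʳ-≤ _ _ (B ^ B * B′ ^ B′) {{m*n≢0 _ _ {{n^n-nonZero B}} {{n^n-nonZero B′}}}} (begin
    p * p′ * X * (B ^ B * B′ ^ B′)
      ≡⟨ solve 5 (λ p q X b d → p :* q :* X :* (b :* d) := p :* b :* (q :* d) :* X) refl p p′ X (B ^ B) (B′ ^ B′) ⟩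
    p * B ^ B * (p′ * B′ ^ B′) * X
      ≤⟨ *-monoˡ-≤ X (*-mono-≤ g g′) ⟩
    c * k ^ B * (c′ * k′ ^ B′) * X
      ≡⟨ solve 5 (λ p q X b d → p :* b :* (q :* d) :* X := p :* q :* (b :* d :* X)) refl c c′ X (k ^ B) (k′ ^ B′) ⟩
    c * c′ * (k ^ B * k′ ^ B′ * X)
      ≤⟨ *-monoʳ-≤ (c * c′) (log-sum B B′ k k′) ⟩
    c * c′ * (B ^ B * B′ ^ B′ * (k + k′) ^ (B + B′))
      ≡⟨ solve 4 (λ p q x y → p :* q :* (x :* y) := p :* q :* y :* x) refl c c′ (B ^ B * B′ ^ B′) ((k + k′) ^ (B + B′)) ⟩
    c * c′ * (k + k′) ^ (B + B′) * (B ^ B * B′ ^ B′) ∎)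
    where X = (B + B′) ^ (B + B′)

  gain-∏ : ∀ {n} {p c B k : Fin n → ℕ} → (∀ i → Gain (p i) (c i) (B i) (k i)) →
    Gain (∏ p) (∏ c) (∑ B) (∑ k)
  gain-∏ {zero}  g = ≤-refl
  gain-∏ {suc n} {p} {c} {B} {k} g = gain-merge {p zero} {_} {c zero} {_} {B zero} (g zero) (gain-∏ (g ∘ suc))

-- Entropy and edge boundaries in product graphs.

module Combinatorics where
  open LogSum
  open import Data.Bool.Base using (if_then_else_; true; false)
  open import Data.Fin.Base as Fin using (Fin; zero; suc; combine; _↑ˡ_; _↑ʳ_)
  import Data.Fin.Properties as Fin
  open import Data.List.Base as List using (List; []; _∷_; filter; length; cartesianProduct)
  import Data.List.Properties as List
  open import Data.Nat.Base
  open import Data.Nat.ListAction using (sum)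
  open import Data.Nat.ListAction.Properties using (sum-++)
  open import Data.Nat.Properties
  open import Data.Product.Base using (∃-syntax; _×_; _,_; proj₁; proj₂)
  open import Data.Sum.Base using (_⊎_; inj₁; inj₂)
  open import Data.Vec.Base using (Vec; []; _∷_; lookup)
  open import Function.Base using (_∘_; id)
  open import Function.Bundles using (Inverse)
  open import Level using (0ℓ)
  open import Relation.Binary.Construct.Closure.ReflexiveTransitive using (Star; ε; _◅_)
  open import Relation.Binary.Definitions using (tri<; tri≈; tri>)
  open import Relation.Binary.PropositionalEquality
  open import Relation.Nullary using (Dec; yes; no; does; ¬_; contradiction)
  open import Relation.Nullary.Decidable using (_×-dec_; _⊎-dec_; ¬?; decidable-stable)
  open import Relation.Unary using (Pred; Decidable)
  open ≤-Reasoning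

  -- Finite sums and products, and Han's inequality for two coordinates.

  ∑-mono : ∀ {n} {f g : Fin n → ℕ} → (∀ i → f i ≤ g i) → ∑ f ≤ ∑ g
  ∑-mono {zero}  h = z≤n
  ∑-mono {suc n} h = +-mono-≤ (h zero) (∑-mono (h ∘ suc))

  f[i]≤∑f : ∀ {n} (f : Fin n → ℕ) i → f i ≤ ∑ f
  f[i]≤∑f f zero    = m≤m+n _ _
  f[i]≤∑f f (suc i) = ≤-trans (f[i]≤∑f (f ∘ suc) i) (m≤n+m _ _)

  *-distribˡ-∑ : ∀ {n} x (f : Fin n → ℕ) → x * ∑ f ≡ ∑ (λ i → x * f i)
  *-distribˡ-∑ {zero}  x f = *-zeroʳ x
  *-distribˡ-∑ {suc n} x f = trans (*-distribˡ-+ x (f zero) _) (cong (x * f zero +_) (*-distribˡ-∑ x (f ∘ suc)))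

  *-distribʳ-∑ : ∀ {n} x (f : Fin n → ℕ) → ∑ f * x ≡ ∑ (λ i → f i * x)
  *-distribʳ-∑ {zero}  x f = refl
  *-distribʳ-∑ {suc n} x f = trans (*-distribʳ-+ x (f zero) _) (cong (f zero * x +_) (*-distribʳ-∑ x (f ∘ suc)))

  ^-∑ : ∀ {n} x (f : Fin n → ℕ) → x ^ ∑ f ≡ ∏ (λ i → x ^ f i)
  ^-∑ {zero}  x f = refl
  ^-∑ {suc n} x f = trans (^-distribˡ-+-* x (f zero) _) (cong (x ^ f zero *_) (^-∑ x (f ∘ suc)))

  ∑-one : ∀ n → ∑ {n} (λ _ → 1) ≡ n
  ∑-one zero    = refl
  ∑-one (suc n) = cong suc (∑-one n)

  ∑-↑ : ∀ m {n} (f : Fin (m + n) → ℕ) → ∑ f ≡ ∑ (f ∘ (_↑ˡ n)) + ∑ (f ∘ (m ↑ʳ_))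
  ∑-↑ zero    f = refl
  ∑-↑ (suc m) f = trans (cong (f zero +_) (∑-↑ m (f ∘ suc))) (sym (+-assoc (f zero) _ _))

  ∑-combine : ∀ m {n} (f : Fin (m * n) → ℕ) → ∑ f ≡ ∑ {m} λ i → ∑ {n} λ j → f (combine i j)
  ∑-combine zero        f = refl
  ∑-combine (suc m) {n} f = trans (∑-↑ n f) (cong (∑ {n} (f ∘ (_↑ˡ m * n)) +_) (∑-combine m (f ∘ (n ↑ʳ_))))

  ∑∑-distrib-+ : ∀ {m n} (f g : Fin m → Fin n → ℕ) →
    ∑ (λ i → ∑ λ j → f i j + g i j) ≡ ∑ (λ i → ∑ λ j → f i j) + ∑ (λ i → ∑ λ j → g i j)
  ∑∑-distrib-+ {m} f g = trans (sum-cong-≗ {m} λ i → ∑-distrib-+ (f i) (g i)) (∑-distrib-+ (∑ ∘ f) (∑ ∘ g))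

  -- H(X ∣ Y) + H(Y ∣ X) ≤ H(X , Y) for (X , Y) uniform on the support of χ.
  ∏-slices≤ : ∀ {g h} (χ : Fin g → Fin h → ℕ) → (∀ i j → χ i j ≤ 1) →
    let row = λ i → ∑ (χ i)
        col = λ j → ∑ λ i → χ i j
        a   = ∑ row
    in ∏ (λ i → row i ^ row i) * ∏ (λ j → col j ^ col j) ≤ a ^ a
  ∏-slices≤ {g} {h} χ χ≤1 = *-cancelʳ-≤ _ _ (a ^ a) {{n^n-nonZero a}} (begin
    ∏ (λ i → row i ^ row i) * ∏ (λ j → col j ^ col j) * a ^ a
      ≡⟨ cong (_* a ^ a) split ⟨
    P * a ^ a
      -- Jensen over the a cells of the support: the product of their values `row i * col j` is at
      -- most (K / a)ᵃ.
      ≤⟨ gain-∏ (λ i → gain-∏ (λ j → cell i j)) ⟩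
    ∏ {g} (λ _ → ∏ {h} (λ _ → 1)) * K ^ a
      ≡⟨ cong (_* K ^ a) (trans (∏-cong {g} (λ i → ∏-one h)) (∏-one g)) ⟩
    1 * K ^ a
      ≡⟨ *-identityˡ _ ⟩
    K ^ a
      ≤⟨ ^-monoˡ-≤ a K≤ ⟩
    (a * a) ^ a
      ≡⟨ ^-distribʳ-* a a a ⟩
    a ^ a * a ^ a ∎)
    where
    row : Fin g → ℕ
    row i = ∑ (χ i)
    col : Fin h → ℕ
    col j = ∑ λ i → χ i j
    a = ∑ row
    P = ∏ λ i → ∏ λ j → (row i * col j) ^ χ i j
    K = ∑ λ i → ∑ λ j → χ i j * (row i * col j)
    cell : ∀ i j → Gain ((row i * col j) ^ χ i j) 1 (χ i j) (χ i j * (row i * col j))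
    cell i j = bit (row i * col j) (χ≤1 i j)
      where
      bit : ∀ x {b} → b ≤ 1 → Gain (x ^ b) 1 b (b * x)
      bit x z≤n       = ≤-refl
      bit x (s≤s z≤n) = ≤-reflexive (trans (*-identityʳ _) (trans (*-identityʳ x)
        (sym (trans (+-identityʳ _) (trans (*-identityʳ _) (+-identityʳ x))))))
    -- Dropping `χ` can only enlarge the sum, which then factors into the row total times the column
    -- total; both are `a`.
    K≤ : K ≤ a * a
    K≤ = begin
      K                                     ≤⟨ ∑-mono (λ i → ∑-mono (λ j → ≤-trans (*-monoˡ-≤ _ (χ≤1 i j)) (≤-reflexive (*-identityˡ _)))) ⟩
      ∑ (λ i → ∑ λ j → row i * col j)       ≡⟨ sum-cong-≗ (λ i → *-distribˡ-∑ (row i) col) ⟨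
      ∑ (λ i → row i * ∑ col)               ≡⟨ *-distribʳ-∑ (∑ col) row ⟨
      a * ∑ col                             ≡⟨ cong (a *_) (∑-comm χ) ⟨
      a * a                                 ∎
    split : P ≡ ∏ (λ i → row i ^ row i) * ∏ (λ j → col j ^ col j)
    split = begin-equality
      P
        ≡⟨ ∏-cong (λ i → trans (∏-cong λ j → ^-distribʳ-* (row i) (col j) (χ i j))
             (∏-distrib-* (λ j → row i ^ χ i j) (λ j → col j ^ χ i j))) ⟩
      ∏ (λ i → ∏ (λ j → row i ^ χ i j) * ∏ (λ j → col j ^ χ i j))
        ≡⟨ ∏-distrib-* (λ i → ∏ λ j → row i ^ χ i j) (λ i → ∏ λ j → col j ^ χ i j) ⟩
      ∏ (λ i → ∏ λ j → row i ^ χ i j) * ∏ (λ i → ∏ λ j → col j ^ χ i j)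
        ≡⟨ cong₂ _*_ (∏-cong λ i → sym (^-∑ (row i) (χ i)))
             (trans (∏-comm (λ i j → col j ^ χ i j)) (∏-cong λ j → sym (^-∑ (col j) (λ i → χ i j)))) ⟩
      ∏ (λ i → row i ^ row i) * ∏ (λ j → col j ^ col j) ∎

  -- Indicators and counting in lists.

  ⟦_⟧ : ∀ {P : Set} → Dec P → ℕ
  ⟦ p ⟧ = if does p then 1 else 0

  ⟦⟧≤1 : ∀ {P : Set} (p : Dec P) → ⟦ p ⟧ ≤ 1
  ⟦⟧≤1 (yes _) = ≤-refl
  ⟦⟧≤1 (no _)  = z≤n

  ⟦⟧-yes : ∀ {P : Set} (p : Dec P) → P → ⟦ p ⟧ ≡ 1
  ⟦⟧-yes (yes _) _ = refl
  ⟦⟧-yes (no ¬p) p = contradiction p ¬p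

  ⟦⟧-no : ∀ {P : Set} (p : Dec P) → ¬ P → ⟦ p ⟧ ≡ 0
  ⟦⟧-no (yes p) ¬p = contradiction p ¬p
  ⟦⟧-no (no _)  _  = refl

  ⟦⟧-mono : ∀ {P Q : Set} (p : Dec P) (q : Dec Q) → (P → Q) → ⟦ p ⟧ ≤ ⟦ q ⟧
  ⟦⟧-mono (yes p) q f = ≤-reflexive (sym (⟦⟧-yes q (f p)))
  ⟦⟧-mono (no _)  q f = z≤n

  length-filter≡sum : ∀ {X : Set} {P : Pred X 0ℓ} (P? : Decidable P) xs →
    length (filter P? xs) ≡ sum (List.map (⟦_⟧ ∘ P?) xs)
  length-filter≡sum P? []       = refl
  length-filter≡sum P? (x ∷ xs) with does (P? x)
  ... | true  = cong suc (length-filter≡sum P? xs)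
  ... | false = length-filter≡sum P? xs

  sum-filter : ∀ {X : Set} {P : Pred X 0ℓ} (P? : Decidable P) (f : X → ℕ) xs →
    sum (List.map f (filter P? xs)) ≡ sum (List.map (λ x → ⟦ P? x ⟧ * f x) xs)
  sum-filter P? f []       = refl
  sum-filter P? f (x ∷ xs) with does (P? x)
  ... | true  = cong₂ _+_ (sym (+-identityʳ (f x))) (sum-filter P? f xs)
  ... | false = sum-filter P? f xs

  sum-cartesianProduct : ∀ {X Y : Set} (f : X × Y → ℕ) xs ys →
    sum (List.map f (cartesianProduct xs ys)) ≡
    sum (List.map (λ x → sum (List.map (λ y → f (x , y)) ys)) xs)
  sum-cartesianProduct f []       ys = refl
  sum-cartesianProduct f (x ∷ xs) ys = begin-equality
    sum (List.map f (List.map (x ,_) ys List.++ cartesianProduct xs ys))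
      ≡⟨ cong sum (List.map-++ f (List.map (x ,_) ys) _) ⟩
    sum (List.map f (List.map (x ,_) ys) List.++ List.map f (cartesianProduct xs ys))
      ≡⟨ sum-++ (List.map f (List.map (x ,_) ys)) _ ⟩
    sum (List.map f (List.map (x ,_) ys)) + sum (List.map f (cartesianProduct xs ys))
      ≡⟨ cong₂ _+_ (cong sum (sym (List.map-∘ ys))) (sum-cartesianProduct f xs ys) ⟩
    sum (List.map (λ y → f (x , y)) ys) + sum (List.map (λ x → sum (List.map (λ y → f (x , y)) ys)) xs) ∎

  sum-tabulate : ∀ {n} (f : Fin n → ℕ) → sum (List.tabulate f) ≡ ∑ f
  sum-tabulate {zero}  f = refl
  sum-tabulate {suc n} f = cong (f zero +_) (sum-tabulate (f ∘ suc))

  -- Size and edge boundary of a set of vertices; isoperimetry of one connected graph.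

  module _ (Γ : Graph) where
    open Graph Γ hiding (V; order)

    vertex : Fin (order Γ) → V Γ
    vertex = Inverse.from enum

    ∑ᵥ : (V Γ → ℕ) → ℕ
    ∑ᵥ f = ∑ (f ∘ vertex)

    sum-vertices : ∀ f → sum (List.map f vertices) ≡ ∑ᵥ f
    sum-vertices f = trans
      (cong sum (trans (cong (List.map f) (List.map-tabulate id vertex)) (List.map-tabulate vertex f)))
      (sum-tabulate (f ∘ vertex))

    f[v]≤∑ᵥf : ∀ f v → f v ≤ ∑ᵥ f
    f[v]≤∑ᵥf f v = subst (λ w → f w ≤ ∑ᵥ f) (Inverse.strictlyInverseʳ enum v) (f[i]≤∑f (f ∘ vertex) (index v))

    module _ {A : Pred (V Γ) 0ℓ} (A? : Decidable A) where
      Leaves : V Γ → V Γ → Set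
      Leaves u v = (A u × ¬ A v) × u ~ v

      leaves? : ∀ u v → Dec (Leaves u v)
      leaves? u v = (A? u ×-dec ¬? (A? v)) ×-dec (u ~? v)

      size : ℕ
      size = ∑ᵥ (⟦_⟧ ∘ A?)

      -- Ordered pairs, with the endpoint in `A` first: every boundary edge has just one such
      -- orientation, so it is counted once.
      boundary : ℕ
      boundary = ∑ᵥ λ u → ∑ᵥ λ v → ⟦ leaves? u v ⟧

      ∣∣ᵥ≡size : ∣ A? ∣ᵥ ≡ size
      ∣∣ᵥ≡size = trans (length-filter≡sum A? vertices) (sum-vertices (⟦_⟧ ∘ A?))

      private
        _<ᵥ?_ : ∀ u v → Dec (index u Fin.< index v)
        u <ᵥ? v = index u Fin.<? index v

        listed : V Γ → V Γ → ℕ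
        listed u v = ⟦ (u <ᵥ? v) ×-dec (u ~? v) ⟧ * ⟦ exactlyOneEndpointIn? A? (u , v) ⟧

        edgeBoundary≡ : edgeBoundary A? ≡ ∑ᵥ λ u → ∑ᵥ λ v → listed u v
        edgeBoundary≡ = trans (length-filter≡sum (exactlyOneEndpointIn? A?) edges)
          (trans (sum-filter (λ (u , v) → (u <ᵥ? v) ×-dec (u ~? v)) _ (cartesianProduct vertices vertices))
          (trans (sum-cartesianProduct _ vertices vertices)
          (trans (sum-vertices _) (sum-cong-≗ {order Γ} λ i → sum-vertices (λ v → listed (vertex i) v)))))

        up down : V Γ → V Γ → ℕ
        up   u v = ⟦ u <ᵥ? v ⟧ * ⟦ leaves? u v ⟧
        down u v = ⟦ v <ᵥ? u ⟧ * ⟦ leaves? u v ⟧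

        -- The endpoints of a leaving pair differ, hence so do their indices, `vertex` being inverse
        -- to `index`.
        orient : ∀ u v → ⟦ leaves? u v ⟧ ≤ up u v + down u v
        orient u v = cover (u <ᵥ? v) (v <ᵥ? u) (leaves? u v) λ ((Au , ¬Av) , _) → ordered Au ¬Av
          where
          cover : ∀ {P Q R : Set} (p : Dec P) (q : Dec Q) (r : Dec R) → (R → P ⊎ Q) →
            ⟦ r ⟧ ≤ ⟦ p ⟧ * ⟦ r ⟧ + ⟦ q ⟧ * ⟦ r ⟧
          cover p q (no _)  f = z≤n
          cover p q (yes r) f with f r
          ... | inj₁ x rewrite ⟦⟧-yes p x = s≤s z≤n
          ... | inj₂ y rewrite ⟦⟧-yes q y = m≤n+m 1 (⟦ p ⟧ * 1)
          ordered : A u → ¬ A v → index u Fin.< index v ⊎ index v Fin.< index u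
          ordered Au ¬Av with Fin.<-cmp (index u) (index v)
          ... | tri< u<v _ _ = inj₁ u<v
          ... | tri> _ _ v<u = inj₂ v<u
          ... | tri≈ _ u≡v _ = contradiction
            (subst A (trans (sym (Inverse.strictlyInverseʳ enum u)) (trans (cong vertex u≡v) (Inverse.strictlyInverseʳ enum v))) Au) ¬Av

        -- Here `l` compares the indices of u and v, `e` and `e′` decide adjacency in either
        -- direction, and `p` and `q` decide membership in `A`. The two orientations out of `A`
        -- exclude each other, so together they use up at most one listed edge.
        merge : ∀ {L E E′ P Q : Set} (l : Dec L) (e : Dec E) (e′ : Dec E′) (p : Dec P) (q : Dec Q) → (E′ → E) →
          ⟦ l ⟧ * ⟦ (p ×-dec ¬? q) ×-dec e ⟧ + ⟦ l ⟧ * ⟦ (q ×-dec ¬? p) ×-dec e′ ⟧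
          ≤ ⟦ l ×-dec e ⟧ * ⟦ (p ×-dec ¬? q) ⊎-dec (¬? p ×-dec q) ⟧
        merge (no _)  e       e′       p       q       f = z≤n
        merge (yes _) (no ¬e) (yes e′) p       q       f = contradiction (f e′) ¬e
        merge (yes _) (no _)  (no _)   (yes _) (yes _) f = z≤n
        merge (yes _) (no _)  (no _)   (yes _) (no _)  f = z≤n
        merge (yes _) (no _)  (no _)   (no _)  (yes _) f = z≤n
        merge (yes _) (no _)  (no _)   (no _)  (no _)  f = z≤n
        merge (yes _) (yes _) e′       (yes _) (yes _) f = z≤n
        merge (yes _) (yes _) e′       (yes _) (no _)  f = ≤-refl
        merge (yes _) (yes _) e′       (no _)  (no _)  f = z≤n
        merge (yes _) (yes _) (yes _)  (no _)  (yes _) f = ≤-refl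
        merge (yes _) (yes _) (no _)   (no _)  (yes _) f = z≤n

      boundary≤edgeBoundary : boundary ≤ edgeBoundary A?
      boundary≤edgeBoundary = begin
        boundary
          ≤⟨ ∑-mono (λ i → ∑-mono (λ j → orient (vertex i) (vertex j))) ⟩
        (∑ᵥ λ u → ∑ᵥ λ v → up u v + down u v)
          ≡⟨ ∑∑-distrib-+ (λ i j → up (vertex i) (vertex j)) (λ i j → down (vertex i) (vertex j)) ⟩
        (∑ᵥ λ u → ∑ᵥ λ v → up u v) + (∑ᵥ λ u → ∑ᵥ λ v → down u v)
          -- Exchanging u and v in the second sum puts both orientations of an edge on the pair in
          -- increasing order of index.
          ≡⟨ cong ((∑ᵥ λ u → ∑ᵥ λ v → up u v) +_) (∑-comm λ i j → down (vertex i) (vertex j)) ⟩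
        (∑ᵥ λ u → ∑ᵥ λ v → up u v) + (∑ᵥ λ u → ∑ᵥ λ v → down v u)
          ≡⟨ ∑∑-distrib-+ (λ i j → up (vertex i) (vertex j)) (λ i j → down (vertex j) (vertex i)) ⟨
        (∑ᵥ λ u → ∑ᵥ λ v → up u v + down v u)
          ≤⟨ ∑-mono (λ i → ∑-mono (λ j → let u = vertex i; v = vertex j in
               merge (u <ᵥ? v) (u ~? v) (v ~? u) (A? u) (A? v) ~-sym)) ⟩
        (∑ᵥ λ u → ∑ᵥ λ v → listed u v)
          ≡⟨ edgeBoundary≡ ⟨
        edgeBoundary A? ∎

      -- The first vertex of the walk outside `A`, together with its predecessor, is a leaving pair.
      crossing : ∀ {u v} → A u → ¬ A v → Star _~_ u v → ∃[ x ] ∃[ y ] Leaves x y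
      crossing Au ¬Av ε = contradiction Au ¬Av
      crossing {u} Au ¬Av (_◅_ {j = w} u~w w⇝v) with A? w
      ... | yes Aw = crossing Aw ¬Av w⇝v
      ... | no ¬Aw = u , w , (Au , ¬Aw) , u~w

      boundary>0 : ∀ {u v} → A u → ¬ A v → Connected → 1 ≤ boundary
      boundary>0 {u} {v} Au ¬Av conn with crossing Au ¬Av (conn u v)
      ... | x , y , lv = begin
        1                                  ≡⟨ ⟦⟧-yes (leaves? x y) lv ⟨
        ⟦ leaves? x y ⟧                    ≤⟨ f[v]≤∑ᵥf (λ y → ⟦ leaves? x y ⟧) y ⟩
        ∑ᵥ (λ y → ⟦ leaves? x y ⟧)         ≤⟨ f[v]≤∑ᵥf (λ x → ∑ᵥ (λ y → ⟦ leaves? x y ⟧)) x ⟩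
        boundary                           ∎

  -- With N the order and k the boundary, this is a log (N / a) ≤ B log (M k / B). The parameter B
  -- stays existential so that bounds for different fibres can be added before the right-hand side
  -- is maximized.
  Isoperimetric : ℕ → Graph → Set₁
  Isoperimetric M Γ = ∀ {A : Pred (V Γ) 0ℓ} (A? : Decidable A) →
    let a = size Γ A? in ∃[ B ] Gain (order Γ ^ a) (a ^ a) B (M * boundary Γ A?)

  -- If `A` is empty or full, then a log (N / a) vanishes and B = 0 serves. Otherwise B = a, and
  -- connectedness gives k ≥ 1, hence M k ≥ N.
  connected⇒isoperimetric : ∀ {M} Γ → Graph.Connected Γ → order Γ ≤ M → Isoperimetric M Γ
  connected⇒isoperimetric {M} Γ conn N≤M A? with Fin.any? (A? ∘ vertex Γ) | Fin.any? (¬? ∘ A? ∘ vertex Γ)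
  ... | no ∄A | _ rewrite trans (sum-cong-≗ λ i → ⟦⟧-no (A? (vertex Γ i)) λ Ai → ∄A (i , Ai)) (sum-replicate-zero (order Γ)) = 0 , ≤-refl
  ... | yes _ | no ∄¬A rewrite trans (sum-cong-≗ λ i → ⟦⟧-yes (A? (vertex Γ i)) (decidable-stable (A? (vertex Γ i)) λ ¬Ai → ∄¬A (i , ¬Ai))) (∑-one (order Γ)) = 0 , ≤-refl
  ... | yes (i , Ai) | yes (j , ¬Aj) = a , (begin
    order Γ ^ a * a ^ a          ≡⟨ *-comm (order Γ ^ a) (a ^ a) ⟩
    a ^ a * order Γ ^ a          ≤⟨ *-monoʳ-≤ (a ^ a) (^-monoˡ-≤ a (begin
      order Γ                      ≤⟨ N≤M ⟩
      M                            ≡⟨ *-identityʳ M ⟨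
      M * 1                        ≤⟨ *-monoʳ-≤ M (boundary>0 Γ A? Ai ¬Aj conn) ⟩
      M * boundary Γ A?            ∎)) ⟩
    a ^ a * (M * boundary Γ A?) ^ a ∎)
    where a = size Γ A?

  -- Fibres of a product graph and induction on the number of factors.

  ∑ᵥ-□ : ∀ {n} G (Gs : Vec Graph n) f → ∑ᵥ (□ (G ∷ Gs)) f ≡ ∑ᵥ G λ u → ∑ᵥ (□ Gs) λ us → f (u , us)
  ∑ᵥ-□ G Gs f = trans (∑-combine (order G) (f ∘ vertex (□ (G ∷ Gs)))) (sum-cong-≗ λ i → sum-cong-≗ λ j →
    cong (λ (k , l) → f (vertex G k , vertex (□ Gs) l)) (Fin.remQuot-combine i j))

  module _ {n} (G : Graph) (Gs : Vec Graph n) {A : Pred (V (□ (G ∷ Gs))) 0ℓ} (A? : Decidable A) where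
    private
      H = □ Gs

      fibreH? : ∀ u → Decidable λ us → A (u , us)
      fibreH? u us = A? (u , us)

      fibreG? : ∀ us → Decidable λ u → A (u , us)
      fibreG? us u = A? (u , us)

      crossH : V G → V H → V H → ℕ
      crossH u us vs = ⟦ leaves? H (fibreH? u) us vs ⟧

      crossG : V H → V G → V G → ℕ
      crossG us u v = ⟦ leaves? G (fibreG? us) u v ⟧

      cross : V G → V H → V G → V H → ℕ
      cross u us v vs = ⟦ leaves? (□ (G ∷ Gs)) A? (u , us) (v , vs) ⟧

      -- If both indicators are 1, the two endpoints coincide and no pair leaves `A`. Otherwise at
      -- most one indicator is 1, and a leaving pair of that fibre is a leaving pair of the product.
      lines≤cross : ∀ u us v vs →
        ⟦ Graph._≟_ G u v ⟧ * crossH u us vs + ⟦ Graph._≟_ H us vs ⟧ * crossG us u v ≤ cross u us v vs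
      lines≤cross u us v vs = go (Graph._≟_ G u v) (Graph._≟_ H us vs)
        where
        go : (p : Dec (u ≡ v)) (q : Dec (us ≡ vs)) → ⟦ p ⟧ * crossH u us vs + ⟦ q ⟧ * crossG us u v ≤ cross u us v vs
        go (no _)     (no _)     = z≤n
        go (yes refl) (yes refl) = ≤-trans (≤-reflexive (cong₂ (λ x y → 1 * x + 1 * y)
          (⟦⟧-no (leaves? H (fibreH? u) us us) λ ((p , ¬p) , _) → ¬p p)
          (⟦⟧-no (leaves? G (fibreG? us) u u) λ ((p , ¬p) , _) → ¬p p))) z≤n
        go (yes refl) (no _)     = ≤-trans (≤-reflexive (trans (+-identityʳ _) (+-identityʳ _)))
          (⟦⟧-mono (leaves? H (fibreH? u) us vs) (leaves? (□ (G ∷ Gs)) A? (u , us) (u , vs))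
            λ (p , j , e , same) → p , suc j , e , λ { zero _ → refl ; (suc l) l≢j → same l (l≢j ∘ cong suc) })
        go (no _)     (yes refl) = ≤-trans (≤-reflexive (+-identityʳ _))
          (⟦⟧-mono (leaves? G (fibreG? us) u v) (leaves? (□ (G ∷ Gs)) A? (u , us) (v , us))
            λ (p , e) → p , zero , e , λ { zero 0≢0 → contradiction refl 0≢0 ; (suc l) _ → refl })

    size-□ : size (□ (G ∷ Gs)) A? ≡ ∑ᵥ G λ u → size H (fibreH? u)
    size-□ = ∑ᵥ-□ G Gs (⟦_⟧ ∘ A?)

    -- Distinct fibres share no edges, and an edge leaving the slice of `A` in a fibre leaves `A` in
    -- the product.
    boundary-□ : (∑ᵥ G λ u → boundary H (fibreH? u)) + (∑ᵥ H λ us → boundary G (fibreG? us)) ≤ boundary (□ (G ∷ Gs)) A?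
    boundary-□ = begin
      (∑ᵥ G λ u → ∑ᵥ H λ us → ∑ᵥ H λ vs → crossH u us vs) + (∑ᵥ H λ us → ∑ᵥ G λ u → ∑ᵥ G λ v → crossG us u v)
        ≡⟨ cong ((∑ᵥ G λ u → ∑ᵥ H λ us → ∑ᵥ H λ vs → crossH u us vs) +_)
             (∑-comm λ j i → ∑ᵥ G λ v → crossG (vertex H j) (vertex G i) v) ⟩
      (∑ᵥ G λ u → ∑ᵥ H λ us → ∑ᵥ H λ vs → crossH u us vs) + (∑ᵥ G λ u → ∑ᵥ H λ us → ∑ᵥ G λ v → crossG us u v)
        ≡⟨ ∑∑-distrib-+ (λ i j → ∑ᵥ H λ vs → crossH (vertex G i) (vertex H j) vs) (λ i j → ∑ᵥ G λ v → crossG (vertex H j) (vertex G i) v) ⟨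
      (∑ᵥ G λ u → ∑ᵥ H λ us → (∑ᵥ H λ vs → crossH u us vs) + (∑ᵥ G λ v → crossG us u v))
        ≤⟨ (∑-mono λ i → ∑-mono λ j → lines (vertex G i) (vertex H j)) ⟩
      (∑ᵥ G λ u → ∑ᵥ H λ us → ∑ᵥ G λ v → ∑ᵥ H λ vs → cross u us v vs)
        ≡⟨ (sum-cong-≗ λ i → sum-cong-≗ λ j → ∑ᵥ-□ G Gs λ w → ⟦ leaves? (□ (G ∷ Gs)) A? (vertex G i , vertex H j) w ⟧) ⟨
      (∑ᵥ G λ u → ∑ᵥ H λ us → ∑ᵥ (□ (G ∷ Gs)) λ w → ⟦ leaves? (□ (G ∷ Gs)) A? (u , us) w ⟧)
        ≡⟨ ∑ᵥ-□ G Gs (λ z → ∑ᵥ (□ (G ∷ Gs)) λ w → ⟦ leaves? (□ (G ∷ Gs)) A? z w ⟧) ⟨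
      boundary (□ (G ∷ Gs)) A? ∎
      where
      -- Trades a fixed coordinate for a sum over all its values, so that fibre sums range over the
      -- same pairs as the product sum.
      select : ∀ Γ (u : V Γ) (f : V Γ → ℕ) → f u ≤ ∑ᵥ Γ λ v → ⟦ Graph._≟_ Γ u v ⟧ * f v
      select Γ u f = begin
        f u                             ≡⟨ *-identityˡ (f u) ⟨
        1 * f u                         ≡⟨ cong (_* f u) (⟦⟧-yes (Graph._≟_ Γ u u) refl) ⟨
        ⟦ Graph._≟_ Γ u u ⟧ * f u       ≤⟨ f[v]≤∑ᵥf Γ (λ v → ⟦ Graph._≟_ Γ u v ⟧ * f v) u ⟩
        (∑ᵥ Γ λ v → ⟦ Graph._≟_ Γ u v ⟧ * f v) ∎

      lines : ∀ u us → (∑ᵥ H λ vs → crossH u us vs) + (∑ᵥ G λ v → crossG us u v) ≤ ∑ᵥ G λ v → ∑ᵥ H λ vs → cross u us v vs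
      lines u us = begin
        (∑ᵥ H λ vs → crossH u us vs) + (∑ᵥ G λ v → crossG us u v)
          ≤⟨ +-mono-≤ (select G u λ _ → ∑ᵥ H λ vs → crossH u us vs) (∑-mono λ i → select H us λ _ → crossG us u (vertex G i)) ⟩
        (∑ᵥ G λ v → ⟦ Graph._≟_ G u v ⟧ * ∑ᵥ H λ vs → crossH u us vs) + (∑ᵥ G λ v → ∑ᵥ H λ vs → ⟦ Graph._≟_ H us vs ⟧ * crossG us u v)
          ≡⟨ cong (_+ (∑ᵥ G λ v → ∑ᵥ H λ vs → ⟦ Graph._≟_ H us vs ⟧ * crossG us u v))
               (sum-cong-≗ λ i → *-distribˡ-∑ ⟦ Graph._≟_ G u (vertex G i) ⟧ (crossH u us ∘ vertex H)) ⟩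
        (∑ᵥ G λ v → ∑ᵥ H λ vs → ⟦ Graph._≟_ G u v ⟧ * crossH u us vs) + (∑ᵥ G λ v → ∑ᵥ H λ vs → ⟦ Graph._≟_ H us vs ⟧ * crossG us u v)
          ≡⟨ ∑∑-distrib-+ (λ i j → ⟦ Graph._≟_ G u (vertex G i) ⟧ * crossH u us (vertex H j)) (λ i j → ⟦ Graph._≟_ H us (vertex H j) ⟧ * crossG us u (vertex G i)) ⟨
        (∑ᵥ G λ v → ∑ᵥ H λ vs → ⟦ Graph._≟_ G u v ⟧ * crossH u us vs + ⟦ Graph._≟_ H us vs ⟧ * crossG us u v)
          ≤⟨ (∑-mono λ i → ∑-mono λ j → lines≤cross u us (vertex G i) (vertex H j)) ⟩
        (∑ᵥ G λ v → ∑ᵥ H λ vs → cross u us v vs) ∎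

  -- Since a is both the row total and the column total, a log (g h) splits into Σ row log h + Σ col
  -- log g. The bounds of all fibres in both directions are merged, `∏-slices≤` puts `a ^ a` in
  -- place of the slice factors, and `boundary-□` collects the boundaries.
  □-isoperimetric : ∀ {M n} G (Gs : Vec Graph n) → Isoperimetric M G → Isoperimetric M (□ Gs) → Isoperimetric M (□ (G ∷ Gs))
  □-isoperimetric {M} G Gs isoG isoH {A} A? = B , (begin
    (g * h) ^ a * B ^ B
      ≡⟨ cong (_* B ^ B) powers ⟩
    ∏ (λ i → h ^ row i) * ∏ (λ j → g ^ col j) * B ^ B
      ≤⟨ gain-merge {∏ (λ i → h ^ row i)} {_} {∏ (λ i → row i ^ row i)} {_} {∑ (proj₁ ∘ rowGain)}
           (gain-∏ (proj₂ ∘ rowGain)) (gain-∏ (proj₂ ∘ colGain)) ⟩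
    ∏ (λ i → row i ^ row i) * ∏ (λ j → col j ^ col j) * K ^ B
      ≤⟨ *-mono-≤ (∏-slices≤ (λ i j → ⟦ A? (vertex G i , vertex H j) ⟧) λ i j → ⟦⟧≤1 (A? (vertex G i , vertex H j))) (^-monoˡ-≤ B K≤) ⟩
    ∑ row ^ ∑ row * (M * boundary (□ (G ∷ Gs)) A?) ^ B
      ≡⟨ cong (λ x → x ^ x * (M * boundary (□ (G ∷ Gs)) A?) ^ B) (size-□ G Gs A?) ⟨
    a ^ a * (M * boundary (□ (G ∷ Gs)) A?) ^ B ∎)
    where
    H = □ Gs
    g = order G
    h = order H
    a = size (□ (G ∷ Gs)) A?
    fibreH? : ∀ i → Decidable λ us → A (vertex G i , us)
    fibreH? i us = A? (vertex G i , us)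
    fibreG? : ∀ j → Decidable λ u → A (u , vertex H j)
    fibreG? j u = A? (u , vertex H j)
    row : Fin g → ℕ
    row i = size H (fibreH? i)
    col : Fin h → ℕ
    col j = size G (fibreG? j)
    rowGain = λ i → isoH (fibreH? i)
    colGain = λ j → isoG (fibreG? j)
    B = ∑ (proj₁ ∘ rowGain) + ∑ (proj₁ ∘ colGain)
    K = ∑ (λ i → M * boundary H (fibreH? i)) + ∑ (λ j → M * boundary G (fibreG? j))
    powers : (g * h) ^ a ≡ ∏ (λ i → h ^ row i) * ∏ (λ j → g ^ col j)
    powers = begin-equality
      (g * h) ^ a          ≡⟨ trans (^-distribʳ-* g h a) (*-comm (g ^ a) (h ^ a)) ⟩
      h ^ a * g ^ a        ≡⟨ cong₂ (λ x y → h ^ x * g ^ y) (size-□ G Gs A?)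
                                (trans (size-□ G Gs A?) (∑-comm λ i j → ⟦ A? (vertex G i , vertex H j) ⟧)) ⟩
      h ^ ∑ row * g ^ ∑ col ≡⟨ cong₂ _*_ (^-∑ h row) (^-∑ g col) ⟩
      ∏ (λ i → h ^ row i) * ∏ (λ j → g ^ col j) ∎
    K≤ : K ≤ M * boundary (□ (G ∷ Gs)) A?
    K≤ = begin
      K ≡⟨ trans (*-distribˡ-+ M (∑ λ i → boundary H (fibreH? i)) _) (cong₂ _+_ (*-distribˡ-∑ M (λ i → boundary H (fibreH? i))) (*-distribˡ-∑ M (λ j → boundary G (fibreG? j)))) ⟨
      M * (∑ (λ i → boundary H (fibreH? i)) + ∑ (λ j → boundary G (fibreG? j))) ≤⟨ *-monoʳ-≤ M (boundary-□ G Gs A?) ⟩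
      M * boundary (□ (G ∷ Gs)) A? ∎

  □[]-isoperimetric : ∀ {M} → Isoperimetric M (□ [])
  □[]-isoperimetric A? = 0 , *-monoˡ-≤ 1 (≤-trans (≤-reflexive (^-zeroˡ a)) (1≤n^n a))
    where a = size (□ []) A?

  product-isoperimetric : ∀ {M n} (Gs : Vec Graph n) → (∀ i → Graph.Connected (lookup Gs i)) →
    (∀ i → order (lookup Gs i) ≤ M) → Isoperimetric M (□ Gs)
  product-isoperimetric {M} [] conn ≤M = □[]-isoperimetric {M}
  product-isoperimetric {M} (G ∷ Gs) conn ≤M = □-isoperimetric {M} G Gs
    (connected⇒isoperimetric G (conn zero) (≤M zero)) (product-isoperimetric Gs (conn ∘ suc) (≤M ∘ suc))

  order≤maxOrder : ∀ {n} (Gs : Vec Graph (suc n)) i → order (lookup Gs i) ≤ maxOrder Gs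
  order≤maxOrder (G ∷ [])         zero    = ≤-refl
  order≤maxOrder (G ∷ Gs@(_ ∷ _)) zero    = m≤m⊔n (order G) (maxOrder Gs)
  order≤maxOrder (G ∷ Gs@(_ ∷ _)) (suc i) = ≤-trans (order≤maxOrder Gs i) (m≤n⊔m (order G) (maxOrder Gs))

  ∣∣ᵥ≤order : ∀ Γ {A : Pred (V Γ) 0ℓ} (A? : Decidable A) → Graph.∣_∣ᵥ Γ A? ≤ order Γ
  ∣∣ᵥ≤order Γ A? = begin
    Graph.∣_∣ᵥ Γ A?             ≡⟨ ∣∣ᵥ≡size Γ A? ⟩
    size Γ A?                   ≤⟨ ∑-mono (λ i → ⟦⟧≤1 (A? (vertex Γ i))) ⟩
    ∑ {order Γ} (λ _ → 1)       ≡⟨ ∑-one (order Γ) ⟩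
    order Γ                     ∎

-- Exponential bounds for the Riemann sums of log and for Euler's sequence.

module RiemannBounds where
  open ℚ-Lemmas
  open Euler-Lemmas
  open Log-Lemmas
  open import Data.Nat.Base as ℕ using (ℕ; zero; suc)
  open import Data.Rational.Base
  import Data.Rational.Properties as ℚ
  open import Data.Rational.Solver using (module +-*-Solver)
  open import Algebra.Definitions.RawSemiring +-*-rawSemiring using (_^_)
  open import Relation.Binary.PropositionalEquality
  open import Relation.Nullary using (yes; no; contradiction)
  open ℚ.≤-Reasoning
  open +-*-Solver using (solve; con; _:+_; _:*_; _:-_; :-_; _:=_)

  0<^ : ∀ {p} k → 0ℚ < p → 0ℚ < p ^ k
  0<^ zero    0<p = ℚ.positive⁻¹ 1ℚ
  0<^ {p} (suc k) 0<p = 0<* {p} {p ^ k} 0<p (0<^ k 0<p)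

  ^-mono : ∀ {p q} k → 0ℚ ≤ p → p ≤ q → p ^ k ≤ q ^ k
  ^-mono zero    0≤p p≤q = ℚ.≤-refl
  ^-mono {p} {q} (suc k) 0≤p p≤q = mul-mono {p} {q} {p ^ k} {q ^ k} (0≤^ k 0≤p) (ℚ.≤-trans 0≤p p≤q) p≤q (^-mono k 0≤p p≤q)

  -- By contraposition; `suc k` excludes the exponent 0, where powers carry no information.
  ^-cancel : ∀ {p q} k → 0ℚ ≤ q → p ^ suc k ≤ q ^ suc k → p ≤ q
  ^-cancel {p} {q} k 0≤q h with p ℚ.≤? q
  ... | yes p≤q = p≤q
  ... | no  p≰q = contradiction (ℚ.<-≤-trans (^-strict k) h) (ℚ.<-irrefl refl)
    where
    q<p : q < p
    q<p = ℚ.≰⇒> p≰q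
    0<p : 0ℚ < p
    0<p = ℚ.≤-<-trans 0≤q q<p
    ^-strict : ∀ k → q ^ suc k < p ^ suc k
    ^-strict k = ℚ.≤-<-trans (mulˡ {q} 0≤q (^-mono k 0≤q (ℚ.<⇒≤ q<p)))
      (ℚ.*-monoˡ-<-pos (p ^ k) {{positive (0<^ k 0<p)}} q<p)

  one-^ : ∀ k → 1ℚ ^ k ≡ 1ℚ
  one-^ zero    = refl
  one-^ (suc k) = trans (ℚ.*-identityˡ (1ℚ ^ k)) (one-^ k)

  ^-+ : ∀ p j k → p ^ (j ℕ.+ k) ≡ p ^ j * p ^ k
  ^-+ p zero    k = sym (ℚ.*-identityˡ (p ^ k))
  ^-+ p (suc j) k = trans (cong (p *_) (^-+ p j k)) (sym (ℚ.*-assoc p (p ^ j) (p ^ k)))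

  ^-* : ∀ p j k → p ^ (j ℕ.* k) ≡ (p ^ k) ^ j
  ^-* p zero    k = refl
  ^-* p (suc j) k = trans (^-+ p k (j ℕ.* k)) (cong (p ^ k *_) (^-* p j k))

  ι-^ : ∀ m k → ι (m ℕ.^ k) ≡ ι m ^ k
  ι-^ m zero    = refl
  ι-^ m (suc k) = trans (ι-* m (m ℕ.^ k)) (cong (ι m *_) (ι-^ m k))

  S-snoc : ∀ n f → S (suc n) f ≡ S n f + f n
  S-snoc zero    f = ℚ.+-comm (f 0) 0ℚ
  S-snoc (suc n) f = trans (cong (f 0 +_) (S-snoc n λ i → f (suc i)))
    (sym (ℚ.+-assoc (f 0) (S n λ i → f (suc i)) (f (suc n))))

  -- exp s ≤ 1 / (1 - s), with exp s approximated from below by (1 + s / K)ᴷ.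
  [1+s/K]^K*[1-s]≤1 : ∀ s k → 0ℚ ≤ s → s ≤ 1ℚ → (1ℚ + s * unit k) ^ suc k * (1ℚ - s) ≤ 1ℚ
  [1+s/K]^K*[1-s]≤1 s k 0≤s s≤1 = begin
    (1ℚ + t) ^ K * (1ℚ - s)              ≡⟨ cong (λ z → (1ℚ + t) ^ K * (1ℚ - z)) s≡ ⟨
    (1ℚ + t) ^ K * (1ℚ - ι K * t)        ≡⟨ cong ((1ℚ + t) ^ K *_) (solve 2 (λ a t → con 1ℚ :- a :* t := con 1ℚ :+ a :* (:- t)) refl (ι K) t) ⟩
    -- Bernoulli replaces 1 - K t by the larger (1 - t)ᴷ, and the paired bases multiply to 1 - t² ≤
    -- 1.
    (1ℚ + t) ^ K * (1ℚ + ι K * (- t))    ≤⟨ mulˡ {(1ℚ + t) ^ K} (0≤^ K 0≤1+t) (bernoulli (- t) K 0≤1-t) ⟩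
    (1ℚ + t) ^ K * (1ℚ - t) ^ K          ≡⟨ *-^ (1ℚ + t) (1ℚ - t) K ⟨
    ((1ℚ + t) * (1ℚ - t)) ^ K            ≤⟨ ^-mono K (0≤* {1ℚ + t} {1ℚ - t} 0≤1+t 0≤1-t) (0≤-⇒≤ {(1ℚ + t) * (1ℚ - t)} {1ℚ}
                                              (ℚ.≤-trans (0≤sq t) (ℚ.≤-reflexive (solve 1 (λ t → t :* t := con 1ℚ :- (con 1ℚ :+ t) :* (con 1ℚ :- t)) refl t)))) ⟩
    1ℚ ^ K                               ≡⟨ one-^ K ⟩
    1ℚ                                   ∎
    where
    K = suc k
    t = s * unit k
    0≤t : 0ℚ ≤ t
    0≤t = 0≤* {s} {unit k} 0≤s (0≤unit k)
    0≤1+t : 0ℚ ≤ 1ℚ + t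
    0≤1+t = 0≤+ {1ℚ} {t} 0≤1 0≤t
    0≤1-t : 0ℚ ≤ 1ℚ - t
    0≤1-t = ≤⇒0≤- {t} {1ℚ} (ℚ.≤-trans (mul-mono {s} {1ℚ} {unit k} {1ℚ} (0≤unit k) 0≤1 s≤1 (unit≤1 k)) (ℚ.≤-reflexive (ℚ.*-identityˡ 1ℚ)))
    s≡ : ι K * t ≡ s
    s≡ = trans (solve 3 (λ a s u → a :* (s :* u) := s :* (a :* u)) refl (ι K) s (unit k))
      (trans (cong (s *_) (ι*unit k)) (ℚ.*-identityʳ s))

  module _ (x : ℚ) (1≤x : 1ℚ ≤ x) (n : ℕ) where
    private
      h = mesh x n
      -- Partition points, shifted against `node` so that `t 0` is the left endpoint 1.
      t : ℕ → ℚ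
      t l = 1ℚ + ι l * h

      0≤h : 0ℚ ≤ h
      0≤h = 0≤* {x - 1ℚ} {unit n} (≤⇒0≤- {1ℚ} {x} 1≤x) (0≤unit n)

      1≤t : ∀ l → 1ℚ ≤ t l
      1≤t l = p≤p+ {1ℚ} {ι l * h} (0≤* {ι l} {h} (0≤ι l) 0≤h)

      0<t : ∀ l → 0ℚ < t l
      0<t l = ℚ.<-≤-trans (ℚ.positive⁻¹ 1ℚ) (1≤t l)

      t-suc : ∀ l → t (suc l) ≡ t l + h
      t-suc l = trans (cong (λ z → 1ℚ + z * h) (ι-suc l))
        (solve 2 (λ a h → con 1ℚ :+ (con 1ℚ :+ a) :* h := (con 1ℚ :+ a :* h) :+ h) refl (ι l) h)

      0≤term : ∀ l → 0ℚ ≤ term x n l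
      0≤term l = 0≤* {rc (t (suc l))} {h} (0≤rc (t (suc l))) 0≤h

      0≤S : ∀ l → 0ℚ ≤ S l (term x n)
      0≤S zero    = ℚ.≤-refl
      0≤S (suc l) = ℚ.≤-trans (0≤+ {S l (term x n)} {term x n l} (0≤S l) (0≤term l)) (ℚ.≤-reflexive (sym (S-snoc l (term x n))))

      -- A term is h divided by the right endpoint of its interval, so 1 minus the term is the ratio
      -- of consecutive partition points.
      t≡ : ∀ l → t l ≡ (1ℚ - term x n l) * t (suc l)
      t≡ l = sym (begin-equality
        (1ℚ - rc t′ * h) * t′   ≡⟨ solve 3 (λ r h t → (con 1ℚ :- r :* h) :* t := t :- h :* (t :* r)) refl (rc t′) h t′ ⟩
        t′ - h * (t′ * rc t′)   ≡⟨ cong (λ z → t′ - h * z) (rc-inv {t′} (0<t (suc l))) ⟩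
        t′ - h * 1ℚ             ≡⟨ cong (λ z → z - h * 1ℚ) (t-suc l) ⟩
        (t l + h) - h * 1ℚ      ≡⟨ solve 2 (λ t h → (t :+ h) :- h :* con 1ℚ := t) refl (t l) h ⟩
        t l ∎)
        where t′ = t (suc l)

      term≤1 : ∀ l → term x n l ≤ 1ℚ
      term≤1 l = begin
        rc t′ * h     ≤⟨ mulˡ {rc t′} {h} {t′} (0≤rc t′) h≤t′ ⟩
        rc t′ * t′    ≡⟨ ℚ.*-comm (rc t′) t′ ⟩
        t′ * rc t′    ≡⟨ rc-inv {t′} (0<t (suc l)) ⟩
        1ℚ            ∎
        where
        t′ = t (suc l)
        h≤t′ : h ≤ t′
        h≤t′ = begin
          h         ≤⟨ p≤p+ {h} {t l} (ℚ.<⇒≤ (0<t l)) ⟩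
          h + t l   ≡⟨ ℚ.+-comm h (t l) ⟩
          t l + h   ≡⟨ t-suc l ⟨
          t′        ∎

      -- Each further term s multiplies the approximate exponential by at most 1 / (1 - s), which is
      -- `t (suc l)` over `t l`, and these ratios telescope.
      exp-S≤t : ∀ k l → (1ℚ + S l (term x n) * unit k) ^ suc k ≤ t l
      exp-S≤t k zero = ℚ.≤-reflexive (begin-equality
        (1ℚ + 0ℚ * unit k) ^ suc k   ≡⟨ cong (_^ suc k) (solve 1 (λ u → con 1ℚ :+ con 0ℚ :* u := con 1ℚ) refl (unit k)) ⟩
        1ℚ ^ suc k                   ≡⟨ one-^ (suc k) ⟩
        1ℚ                           ≡⟨ solve 1 (λ h → con 1ℚ := con 1ℚ :+ con 0ℚ :* h) refl h ⟩
        t 0                          ∎)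
      exp-S≤t k (suc l) = begin
        (1ℚ + S (suc l) (term x n) * u) ^ K   ≡⟨ cong (λ z → (1ℚ + z * u) ^ K) (S-snoc l (term x n)) ⟩
        -- The approximation (1 + y / K)ᴷ is submultiplicative in y, the product of two bases having
        -- the extra term (a u)(s u).
        (1ℚ + (a + s) * u) ^ K                ≤⟨ ^-mono K (0≤+ {1ℚ} {(a + s) * u} 0≤1 (0≤* {a + s} {u} (0≤+ {a} {s} (0≤S l) (0≤term l)) (0≤unit k))) expand ⟩
        ((1ℚ + a * u) * (1ℚ + s * u)) ^ K     ≡⟨ *-^ (1ℚ + a * u) (1ℚ + s * u) K ⟩
        (1ℚ + a * u) ^ K * E                  ≤⟨ mulʳ {E} 0≤E (exp-S≤t k l) ⟩
        t l * E                               ≡⟨ cong (_* E) (t≡ l) ⟩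
        (1ℚ - s) * t (suc l) * E              ≡⟨ solve 3 (λ s t e → (con 1ℚ :- s) :* t :* e := e :* (con 1ℚ :- s) :* t) refl s (t (suc l)) E ⟩
        E * (1ℚ - s) * t (suc l)              ≤⟨ mulʳ {t (suc l)} (ℚ.<⇒≤ (0<t (suc l))) ([1+s/K]^K*[1-s]≤1 s k (0≤term l) (term≤1 l)) ⟩
        1ℚ * t (suc l)                        ≡⟨ ℚ.*-identityˡ (t (suc l)) ⟩
        t (suc l)                             ∎
        where
        K = suc k
        u = unit k
        a = S l (term x n)
        s = term x n l
        E = (1ℚ + s * u) ^ K
        0≤au = 0≤* {a} {u} (0≤S l) (0≤unit k)
        0≤su = 0≤* {s} {u} (0≤term l) (0≤unit k)
        0≤E : 0ℚ ≤ E
        0≤E = 0≤^ K (0≤+ {1ℚ} {s * u} 0≤1 0≤su)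
        expand : 1ℚ + (a + s) * u ≤ (1ℚ + a * u) * (1ℚ + s * u)
        expand = begin
          1ℚ + (a + s) * u                         ≤⟨ p≤p+ {1ℚ + (a + s) * u} {(a * u) * (s * u)} (0≤* {a * u} {s * u} 0≤au 0≤su) ⟩
          1ℚ + (a + s) * u + (a * u) * (s * u)     ≡⟨ solve 3 (λ a s u → con 1ℚ :+ (a :+ s) :* u :+ (a :* u) :* (s :* u) := (con 1ℚ :+ a :* u) :* (con 1ℚ :+ s :* u)) refl a s u ⟩
          (1ℚ + a * u) * (1ℚ + s * u)              ∎

    -- Right endpoints underestimate ∫ dt/t, so the Riemann sum r satisfies exp r ≤ x.
    exp-riemann≤ : ∀ .{{_ : Positive x}} k → (1ℚ + riemann x n * unit k) ^ suc k ≤ x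
    exp-riemann≤ k = begin
      (1ℚ + riemann x n * unit k) ^ suc k            ≡⟨ cong (λ z → (1ℚ + z * unit k) ^ suc k) (riemann≡S x n) ⟩
      (1ℚ + S (suc n) (term x n) * unit k) ^ suc k   ≤⟨ exp-S≤t k (suc n) ⟩
      1ℚ + ι (suc n) * ((x - 1ℚ) * unit n)           ≡⟨ solve 3 (λ a x u → con 1ℚ :+ a :* ((x :- con 1ℚ) :* u) := con 1ℚ :+ (x :- con 1ℚ) :* (a :* u)) refl (ι (suc n)) x (unit n) ⟩
      1ℚ + (x - 1ℚ) * (ι (suc n) * unit n)           ≡⟨ cong (λ z → 1ℚ + (x - 1ℚ) * z) (ι*unit n) ⟩
      1ℚ + (x - 1ℚ) * 1ℚ                             ≡⟨ solve 1 (λ x → con 1ℚ :+ (x :- con 1ℚ) :* con 1ℚ := x) refl x ⟩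
      x                                              ∎

    0≤riemann : ∀ .{{_ : Positive x}} → 0ℚ ≤ riemann x n
    0≤riemann = ℚ.≤-trans (0≤S (suc n)) (ℚ.≤-reflexive (sym (riemann≡S x n)))

  -- e s ≤ exp s. Factor 1 + s / (N + 1) = (1 + 1 / N) w, where Bernoulli gives wᴺ⁺¹ ≥ s N / (N + 1).
  e*s≤exp[s] : ∀ n s → 0ℚ ≤ s → eulerSeq n * s ≤ (1ℚ + s * unit (suc n)) ^ suc (suc n)
  e*s≤exp[s] n s 0≤s = begin
    p ^ N * s                            ≡⟨ cong (_* s) (trans (solve 2 (λ e a → e := e :* con 1ℚ) refl (p ^ N) p) (cong (p ^ N *_) (sym p[1-w]))) ⟩
    p ^ N * (p * (1ℚ - u)) * s           ≡⟨ solve 4 (λ e p u s → e :* (p :* (con 1ℚ :- u)) :* s := p :* e :* (s :* (con 1ℚ :- u))) refl (p ^ N) p u s ⟩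
    p ^ suc N * (s * (1ℚ - u))           ≡⟨ cong (p ^ suc N *_) bern ⟨
    p ^ suc N * (1ℚ + ι (suc N) * d)     ≤⟨ mulˡ {p ^ suc N} (0≤^ (suc N) (1+ι≥0 n)) (bernoulli d (suc N) 0≤1+d) ⟩
    p ^ suc N * (1ℚ + d) ^ suc N         ≡⟨ *-^ p (1ℚ + d) (suc N) ⟨
    (p * (1ℚ + d)) ^ suc N               ≡⟨ cong (_^ suc N) factor ⟩
    (1ℚ + s * u) ^ suc N                 ∎
    where
    N = suc n
    v = unit n
    u = unit N
    p = 1ℚ + v
    -- The factor w is 1 + d, equal to (1 - u)(1 + s u), where 1 - u = N / (N + 1) is the inverse of
    -- `p`.
    d = u * (s * (1ℚ - u) - 1ℚ)
    p[1-w] : p * (1ℚ - u) ≡ 1ℚ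
    p[1-w] = begin-equality
      (1ℚ + v) * (1ℚ - u)       ≡⟨ solve 2 (λ v w → (con 1ℚ :+ v) :* (con 1ℚ :- w) := con 1ℚ :- w :+ v :* (con 1ℚ :- w)) refl v u ⟩
      1ℚ - u + v * (1ℚ - u)     ≡⟨ cong (λ z → 1ℚ - u + z) (unit-rel n) ⟨
      1ℚ - u + u                ≡⟨ solve 1 (λ w → con 1ℚ :- w :+ w := con 1ℚ) refl u ⟩
      1ℚ                        ∎
    bern : 1ℚ + ι (suc N) * d ≡ s * (1ℚ - u)
    bern = begin-equality
      1ℚ + ι (suc N) * (u * (s * (1ℚ - u) - 1ℚ))   ≡⟨ cong (1ℚ +_) (ℚ.*-assoc (ι (suc N)) u (s * (1ℚ - u) - 1ℚ)) ⟨
      1ℚ + (ι (suc N) * u) * (s * (1ℚ - u) - 1ℚ)   ≡⟨ cong (λ z → 1ℚ + z * (s * (1ℚ - u) - 1ℚ)) (ι*unit N) ⟩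
      1ℚ + 1ℚ * (s * (1ℚ - u) - 1ℚ)                ≡⟨ solve 1 (λ a → con 1ℚ :+ con 1ℚ :* (a :- con 1ℚ) := a) refl (s * (1ℚ - u)) ⟩
      s * (1ℚ - u) ∎
    1+d≡ : 1ℚ + d ≡ (1ℚ - u) * (1ℚ + s * u)
    1+d≡ = solve 2 (λ s u → con 1ℚ :+ u :* (s :* (con 1ℚ :- u) :- con 1ℚ) := (con 1ℚ :- u) :* (con 1ℚ :+ s :* u)) refl s u
    0≤1+d : 0ℚ ≤ 1ℚ + d
    0≤1+d = ℚ.≤-trans (0≤* {1ℚ - u} {1ℚ + s * u} (≤⇒0≤- {u} {1ℚ} (unit≤1 N))
      (0≤+ {1ℚ} {s * u} 0≤1 (0≤* {s} {u} 0≤s (0≤unit N)))) (ℚ.≤-reflexive (sym 1+d≡))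
    factor : p * (1ℚ + d) ≡ 1ℚ + s * u
    factor = begin-equality
      p * (1ℚ + d)                       ≡⟨ cong (p *_) 1+d≡ ⟩
      p * ((1ℚ - u) * (1ℚ + s * u))      ≡⟨ ℚ.*-assoc p (1ℚ - u) (1ℚ + s * u) ⟨
      (p * (1ℚ - u)) * (1ℚ + s * u)      ≡⟨ cong (_* (1ℚ + s * u)) p[1-w] ⟩
      1ℚ * (1ℚ + s * u)                  ≡⟨ ℚ.*-identityˡ _ ⟩
      1ℚ + s * u                         ∎

-- From products of natural numbers to rational approximations of e and log.

module RationalBound where
  open ℚ-Lemmas
  open Euler-Lemmas
  open LogSum using (Gain)
  open RiemannBounds
  open import Data.Integer.Base as ℤ using ()
  import Data.Integer.Properties as ℤ
  open import Data.Nat.Base as ℕ using (ℕ; zero; suc)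
  import Data.Nat.Properties as ℕ
  open import Data.Nat.Solver renaming (module +-*-Solver to ℕ-Solver)
  open import Data.Product.Base using (∃-syntax; _,_)
  open import Data.Rational.Base
  open import Algebra.Definitions.RawSemiring +-*-rawSemiring using (_^_)
  import Data.Rational.Properties as ℚ
  open import Data.Rational.Solver using (module +-*-Solver)
  import Data.Rational.Unnormalised.Base as ℚᵘ
  import Data.Rational.Unnormalised.Properties as ℚᵘ
  open import Relation.Binary.PropositionalEquality
  open ℚ.≤-Reasoning
  open +-*-Solver using (solve; con; _:+_; _:*_; _:-_; :-_; _:=_)

  -- Put s = a r / B. From exp r ≤ x and the gain, exp (a r) ≤ (N / a)ᵃ ≤ (K / B)ᴮ, so exp s ≤ K /
  -- B, and e s ≤ exp s yields the claim. Every exponential here stands for a power (1 + y / j)ʲ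
  -- with a suitable j.
  e*log≤gain : ∀ {N a B K x r} → 0ℚ < ι a → ι a * x ≡ ι N → Gain (N ℕ.^ a) (a ℕ.^ a) B K →
    0ℚ ≤ r → (∀ k → (1ℚ + r * unit k) ^ suc k ≤ x) → ∀ n → eulerSeq n * (ι a * r) ≤ ι K
  e*log≤gain {N} {a} {B} {K} {x} {r} 0<a a*x≡N gain 0≤r exp≤x n = by-cases B gainℚ
    where
    0≤ru : ∀ k → 0ℚ ≤ 1ℚ + r * unit k
    0≤ru k = 0≤+ {1ℚ} {r * unit k} 0≤1 (0≤* {r} {unit k} 0≤r (0≤unit k))

    gainℚ : ∀ k → ((1ℚ + r * unit k) ^ suc k) ^ a * ι B ^ B ≤ ι K ^ B
    gainℚ k = ℚ.*-cancelˡ-≤-pos (ι a ^ a) {{positive (0<^ a 0<a)}} (begin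
      ι a ^ a * (E ^ a * ι B ^ B)     ≤⟨ mulˡ {ι a ^ a} (0≤^ a (0≤ι a)) (mulʳ {ι B ^ B} (0≤^ B (0≤ι B)) (^-mono a (0≤^ (suc k) (0≤ru k)) (exp≤x k))) ⟩
      ι a ^ a * (x ^ a * ι B ^ B)     ≡⟨ ℚ.*-assoc (ι a ^ a) (x ^ a) (ι B ^ B) ⟨
      ι a ^ a * x ^ a * ι B ^ B       ≡⟨ cong (_* ι B ^ B) (trans (sym (*-^ (ι a) x a)) (cong (_^ a) a*x≡N)) ⟩
      ι N ^ a * ι B ^ B               ≡⟨ trans (ι-* (N ℕ.^ a) (B ℕ.^ B)) (cong₂ _*_ (ι-^ N a) (ι-^ B B)) ⟨
      ι (N ℕ.^ a ℕ.* B ℕ.^ B)         ≤⟨ ι-mono gain ⟩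
      ι (a ℕ.^ a ℕ.* K ℕ.^ B)         ≡⟨ trans (ι-* (a ℕ.^ a) (K ℕ.^ B)) (cong₂ _*_ (ι-^ a a) (ι-^ K B)) ⟩
      ι a ^ a * ι K ^ B               ∎)
      where E = (1ℚ + r * unit k) ^ suc k

    0≤e : 0ℚ ≤ eulerSeq n
    0≤e = 0≤^ (suc n) (1+ι≥0 n)

    by-cases : ∀ B → (∀ k → ((1ℚ + r * unit k) ^ suc k) ^ a * ι B ^ B ≤ ι K ^ B) → eulerSeq n * (ι a * r) ≤ ι K
    -- With B = 0, the instance k = 0 of the gain reads (1 + r)ᵃ ≤ 1, and Bernoulli forces a r ≤ 0.
    by-cases zero g = begin
      eulerSeq n * (ι a * r)    ≤⟨ mulˡ {eulerSeq n} 0≤e ar≤0 ⟩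
      eulerSeq n * 0ℚ           ≡⟨ ℚ.*-zeroʳ (eulerSeq n) ⟩
      0ℚ                        ≤⟨ 0≤ι K ⟩
      ι K                       ∎
      where
      ar≤0 : ι a * r ≤ 0ℚ
      ar≤0 = ℚ.≤-trans (ℚ.≤-reflexive (solve 1 (λ y → y := :- con 1ℚ :+ (con 1ℚ :+ y)) refl (ι a * r)))
        (ℚ.+-monoʳ-≤ (- 1ℚ) (begin
        1ℚ + ι a * r                               ≤⟨ bernoulli r a (0≤+ {1ℚ} {r} 0≤1 0≤r) ⟩
        (1ℚ + r) ^ a                               ≡⟨ cong (_^ a) (solve 1 (λ r → con 1ℚ :+ r := (con 1ℚ :+ r :* con 1ℚ) :* con 1ℚ) refl r) ⟩
        ((1ℚ + r * unit 0) ^ 1) ^ a                ≡⟨ ℚ.*-identityʳ _ ⟨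
        ((1ℚ + r * unit 0) ^ 1) ^ a * 1ℚ           ≤⟨ g 0 ⟩
        1ℚ                                         ∎))
    by-cases B@(suc b) g = begin
      eulerSeq n * (ι a * r)          ≡⟨ cong (eulerSeq n *_) s*B ⟨
      eulerSeq n * (s * ι B)          ≡⟨ ℚ.*-assoc (eulerSeq n) s (ι B) ⟨
      eulerSeq n * s * ι B            ≤⟨ mulʳ {ι B} (0≤ι B) (e*s≤exp[s] n s 0≤s) ⟩
      (1ℚ + s * unit (suc n)) ^ L * ι B
                                      ≤⟨ ^-cancel b (0≤ι K) power ⟩
      ι K                             ∎
      where
      L = suc (suc n)
      -- Chosen so that `suc k` equals `L * B`: the power supplied by `g` splits into exponents L
      -- and B, and `unit (suc n)` is B times `unit k`.
      k = b ℕ.+ suc n ℕ.* suc b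
      u = unit k
      s = ι a * r * unit b
      0≤ar : 0ℚ ≤ ι a * r
      0≤ar = 0≤* {ι a} {r} (0≤ι a) 0≤r
      0≤s : 0ℚ ≤ s
      0≤s = 0≤* {ι a * r} {unit b} 0≤ar (0≤unit b)
      0≤aru : 0ℚ ≤ 1ℚ + ι a * (r * u)
      0≤aru = 0≤+ {1ℚ} {ι a * (r * u)} 0≤1 (0≤* {ι a} {r * u} (0≤ι a) (0≤* {r} {u} 0≤r (0≤unit k)))
      s*B : s * ι B ≡ ι a * r
      s*B = trans (solve 3 (λ y v B → y :* v :* B := y :* (B :* v)) refl (ι a * r) (unit b) (ι B))
        (trans (cong (ι a * r *_) (ι*unit b)) (ℚ.*-identityʳ _))
      s*unit : s * unit (suc n) ≡ ι a * (r * u)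
      s*unit = trans (cong (s *_) (unit-* (suc n) b))
        (trans (sym (ℚ.*-assoc s (ι B) u)) (trans (cong (_* u) s*B) (ℚ.*-assoc (ι a) r u)))
      power : ((1ℚ + s * unit (suc n)) ^ L * ι B) ^ B ≤ ι K ^ B
      power = begin
        ((1ℚ + s * unit (suc n)) ^ L * ι B) ^ B          ≡⟨ *-^ ((1ℚ + s * unit (suc n)) ^ L) (ι B) B ⟩
        ((1ℚ + s * unit (suc n)) ^ L) ^ B * ι B ^ B      ≡⟨ cong (λ z → ((1ℚ + z) ^ L) ^ B * ι B ^ B) s*unit ⟩
        -- Bernoulli turns the factor a into an exponent, as the gain has it.
        ((1ℚ + ι a * (r * u)) ^ L) ^ B * ι B ^ B         ≤⟨ mulʳ {ι B ^ B} (0≤^ B (0≤ι B))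
                                                              (^-mono B (0≤^ L 0≤aru) (^-mono L 0≤aru (bernoulli (r * u) a (0≤ru k)))) ⟩
        (((1ℚ + r * u) ^ a) ^ L) ^ B * ι B ^ B           ≡⟨ cong (_* ι B ^ B) exponents ⟩
        ((1ℚ + r * u) ^ suc k) ^ a * ι B ^ B             ≤⟨ g k ⟩
        ι K ^ B                                          ∎
        where
        p = 1ℚ + r * u
        exponents : ((p ^ a) ^ L) ^ B ≡ (p ^ (L ℕ.* B)) ^ a
        exponents = begin-equality
          ((p ^ a) ^ L) ^ B       ≡⟨ cong (_^ B) (^-* p L a) ⟨
          (p ^ (L ℕ.* a)) ^ B     ≡⟨ ^-* p B (L ℕ.* a) ⟨
          p ^ (B ℕ.* (L ℕ.* a))   ≡⟨ cong (p ^_) (ℕ-Solver.solve 3 (λ B L a → B ℕ-Solver.:* (L ℕ-Solver.:* a) ℕ-Solver.:= a ℕ-Solver.:* (L ℕ-Solver.:* B)) refl B L a) ⟩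
          p ^ (a ℕ.* (L ℕ.* B))   ≡⟨ ^-* p a (L ℕ.* B) ⟩
          (p ^ (L ℕ.* B)) ^ a     ∎

  /≡ι*unit : ∀ N a → (ℤ.+ N) / suc a ≡ ι N * unit a
  /≡ι*unit N a = ℚ.toℚᵘ-injective (ℚᵘ.≃-trans (ℚ.toℚᵘ-fromℚᵘ (ℚᵘ.mkℚᵘ (ℤ.+ N) a))
    (ℚᵘ.≃-sym (ℚᵘ.≃-trans (ℚ.toℚᵘ-homo-* (ι N) (unit a))
      (ℚᵘ.≃-trans (ℚᵘ.*-cong (ℚ.toℚᵘ-fromℚᵘ (ℚᵘ.mkℚᵘ (ℤ.+ N) 0)) (ℚ.toℚᵘ-fromℚᵘ (ℚᵘ.mkℚᵘ (ℤ.+ 1) a)))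
        (ℚᵘ.≃-reflexive (cong₂ ℚᵘ.mkℚᵘ (ℤ.*-identityʳ (ℤ.+ N)) (ℕ.+-identityʳ a)))))))

  -- The left-hand side is term n of the sequence for |A| (e / M) log (N / |A|), so the bound holds
  -- termwise, before any limit. Given `e*log≤gain`, what remains is to cancel M.
  gain⇒bound : ∀ N a M D .{{_ : ℕ.NonZero a}} .{{_ : ℕ.NonZero M}} .{{_ : Positive ((ℤ.+ N) / a)}} →
    a ℕ.≤ N → ∃[ B ] Gain (N ℕ.^ a) (a ℕ.^ a) B (M ℕ.* D) →
    ∀ n → ι a * (eulerSeq n * ((ℤ.+ 1) / M)) * riemann ((ℤ.+ N) / a) n ≤ ι D
  gain⇒bound N (suc a) (suc m) D a≤N (B , gain) n = begin
    ι A * (e * w) * r          ≡⟨ solve 4 (λ A e w r → A :* (e :* w) :* r := e :* (A :* r) :* w) refl (ι A) e w r ⟩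
    e * (ι A * r) * w          ≤⟨ mulʳ {w} (0≤unit m) (e*log≤gain {N} {A} {B} {M ℕ.* D} {x} {r}
                                    (ℚ.<-≤-trans (ℚ.positive⁻¹ 1ℚ) (ι-mono (ℕ.s≤s (ℕ.z≤n {a}))))
                                    A*x≡N gain (0≤riemann x 1≤x n) (exp-riemann≤ x 1≤x n) n) ⟩
    ι (M ℕ.* D) * w            ≡⟨ cong (_* w) (ι-* M D) ⟩
    ι M * ι D * w              ≡⟨ solve 3 (λ M D w → M :* D :* w := D :* (M :* w)) refl (ι M) (ι D) w ⟩
    ι D * (ι M * w)            ≡⟨ cong (ι D *_) (ι*unit m) ⟩
    ι D * 1ℚ                   ≡⟨ ℚ.*-identityʳ (ι D) ⟩
    ι D                        ∎
    where
    A = suc a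
    M = suc m
    e = eulerSeq n
    w = unit m
    x = (ℤ.+ N) / A
    r = riemann x n
    A*x≡N : ι A * x ≡ ι N
    A*x≡N = begin-equality
      ι A * x                  ≡⟨ cong (ι A *_) (/≡ι*unit N a) ⟩
      ι A * (ι N * unit a)     ≡⟨ solve 3 (λ A N u → A :* (N :* u) := N :* (A :* u)) refl (ι A) (ι N) (unit a) ⟩
      ι N * (ι A * unit a)     ≡⟨ cong (ι N *_) (ι*unit a) ⟩
      ι N * 1ℚ                 ≡⟨ ℚ.*-identityʳ (ι N) ⟩
      ι N                      ∎
    -- From a ≤ N; the bounds on the Riemann sums are those for x ≥ 1.
    1≤x : 1ℚ ≤ x
    1≤x = begin
      1ℚ                       ≡⟨ ι*unit a ⟨
      ι A * unit a             ≤⟨ mulʳ {unit a} (0≤unit a) (ι-mono a≤N) ⟩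
      ι N * unit a             ≡⟨ /≡ι*unit N a ⟨
      x                        ∎

-- The inequality between real numbers.

open LogSum using (Gain)
open Combinatorics
open RationalBound using (gain⇒bound)
open ℚ-Lemmas using (p≤p+; ι-mono)

mainTheorem4 : ∀ {n} (G : Vec Graph (suc n)) (d : Fin (suc n) → ℕ) →
    (∀ i → Graph.Connected (lookup G i)) →
    (∀ i → Graph.Regular (lookup G i) (d i)) →
    (A : Pred (V (□ G)) 0ℓ) (A? : Decidable A) (A≢∅ : Satisfiable A) →
    fromℕ (Graph.edgeBoundary (□ G) A?)
    ≥ℝ fromℕ (Graph.∣_∣ᵥ (□ G) A?)
    *ℝ (𝕖 /ℝ maxOrder G) {{maxOrder-nonZero G (proj₁ A≢∅)}}
    *ℝ log (coDensity (□ G) A? A≢∅) {{coDensity-positive (□ G) A? A≢∅}}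
-- The rational inequality holds at every index, so 0 serves as the threshold in `_≤ℝ_`, and ε is
-- added at the end.
mainTheorem4 G d conn _ A A? A≢∅ ε 0<ε = 0 , λ n _ → ℚ.≤-trans
  (gain⇒bound (order Γ) (Graph.∣_∣ᵥ Γ A?) (maxOrder G) (boundary Γ A?)
    {{∣∣-nonZero Γ A? A≢∅}} {{maxOrder-nonZero G (proj₁ A≢∅)}} {{coDensity-positive Γ A? A≢∅}}
    (∣∣ᵥ≤order Γ A?)
    (subst (λ a → ∃[ B ] Gain (order Γ ℕ.^ a) (a ℕ.^ a) B (maxOrder G ℕ.* boundary Γ A?)) (sym (∣∣ᵥ≡size Γ A?))
      (product-isoperimetric G conn (order≤maxOrder G) A?)) n)
  (ℚ.≤-trans (ι-mono (boundary≤edgeBoundary Γ A?)) (p≤p+ (ℚ.<⇒≤ 0<ε)))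
  where Γ = □ G
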